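{- For every graph $H$, integer $t>0$ and real $\alpha>0$ there exists $\delta>0$ such that every $H$-minor-free graph $G$ with $|E(G)|\le(t-\alpha)|V(G)|$ contains at least $\delta|V(G)|$ pairwise disjoint $t$-islands.
   Context: All graphs are finite and simple. A $t$-island in a graph $G$ is a non-empty set $S\subseteq V(G)$ such that every vertex of $S$ has fewer than $t$ neighbors in $V(G)\setminus S$. -}

module Defs where

open import Data.Nat using (ℕ; zero; suc; _+_; _<_; _<ᵇ_)
open import Data.Bool using (Bool; true; false; if_then_else_; _∧_; not)
open import Data.Fin using (Fin; toℕ)
import Data.Fin as Fin
open import Data.Fin.Subset using (Subset; _∈_; Nonempty)
open import Data.Vec using (lookup)
open import Data.Product using (Σ; ∃; ∃₂; _×_)
open import Data.List using (List)
open import Data.List.Relation.Unary.All using (All)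
open import Data.List.Relation.Unary.AllPairs using (AllPairs)
open import Relation.Binary.PropositionalEquality using (_≡_; _≢_)
open import Relation.Nullary using (¬_)
open import Data.Empty using (⊥)

record Graph : Set where
  field
    n      : ℕ
    adj    : Fin n → Fin n → Bool
    sym    : ∀ u v → adj u v ≡ adj v u
    irrefl : ∀ v → adj v v ≡ false
open Graph public

count : ∀ {n} → (Fin n → Bool) → ℕ
count {zero}  f = 0
count {suc n} f = (if f Fin.zero then 1 else 0) + count (λ i → f (Fin.suc i))

sumFin : ∀ {n} → (Fin n → ℕ) → ℕ
sumFin {zero}  f = 0
sumFin {suc n} f = f Fin.zero + sumFin (λ i → f (Fin.suc i))

∣V∣ : Graph → ℕ
∣V∣ G = n G

∣E∣ : Graph → ℕ
∣E∣ G = sumFin (λ i → count (λ j → adj G i j ∧ (toℕ i <ᵇ toℕ j)))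

outDeg : (G : Graph) → Subset (n G) → Fin (n G) → ℕ
outDeg G S v = count (λ w → adj G v w ∧ not (lookup S w))

IsIsland : (G : Graph) → ℕ → Subset (n G) → Set
IsIsland G t S = Nonempty S × (∀ v → v ∈ S → outDeg G S v < t)

Disjoint : ∀ {m} → Subset m → Subset m → Set
Disjoint A B = ∀ v → v ∈ A → v ∈ B → ⊥

data WalkIn (G : Graph) (S : Subset (n G)) : Fin (n G) → Fin (n G) → Set where
  here : ∀ {v} → v ∈ S → WalkIn G S v v
  step : ∀ {u v w} → u ∈ S → adj G u v ≡ true → WalkIn G S v w → WalkIn G S u w

ConnectedIn : (G : Graph) → Subset (n G) → Set
ConnectedIn G S = ∀ u v → u ∈ S → v ∈ S → WalkIn G S u v

IsMinorOf : Graph → Graph → Set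
IsMinorOf H G =
  Σ (Fin (n H) → Subset (n G)) λ B →
    (∀ h → Nonempty (B h)) ×
    (∀ h h′ → h ≢ h′ → Disjoint (B h) (B h′)) ×
    (∀ h → ConnectedIn G (B h)) ×
    (∀ h h′ → adj H h h′ ≡ true →
       ∃₂ λ u v → u ∈ B h × v ∈ B h′ × adj G u v ≡ true)

MinorFree : Graph → Graph → Set
MinorFree H G = ¬ IsMinorOf H G

{-# OPTIONS --safe #-}
-- Delete the few vertices of large degree, and then, |V(H)| times in a row, every Δ-th layer of the breadth-first
-- layerings of what remains, starting from the sparsest residue class (Klein, Plotkin and Rao).  Few vertices are
-- deleted in total.  If a remaining piece contained |V(H)| + 2 vertices pairwise far apart, then climbing from them
-- towards the roots of the successive layerings would yield a complete bipartite minor and hence an H-minor; so, the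
-- degree being bounded, all pieces have bounded size.
-- Let Q be obtained from the deleted set by repeatedly adding a vertex with at least t neighbours in Q.  Every addition
-- accounts for t edges, so the edge bound forces the complement of Q to have linear size.  Its trace on each piece has
-- fewer than t outside neighbours at every vertex and bounded size, hence linearly many of these traces are islands.
module Submission where

open import Defs

-- Far apart means: joined by no short walk through low-degree vertices, even one that leaves the
-- piece. Only this weak diameter of a piece can be bounded, since the columns of the minor leave
-- the piece in which they start. It is enough, because a ball of fixed radius among the low-degree
-- vertices has bounded size. The minor gains one row per layering, from the innermost layering
-- outwards: the new row is a ball around a root, and each column is prolonged to touch it. The
-- obstacle is that a prolonged column might run into an older row. Therefore each column carries a
-- tip at distance more than Δ from every row, measured in the current vertex set. The older rows
-- lie in a band of Δ consecutive levels, so a path descending from the tip could meet them only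
-- within Δ steps. As for the constants, let `q` be a positive integer with αq ≥ 1. The edge bound,
-- doubled and multiplied by `q`, leaves a slack of twice the number `N` of vertices. Deleting at
-- most `N / (2qt)` vertices spends half of it; the degree threshold and Δ are chosen so that each
-- kind of deletion is responsible for at most half of these vertices.

module Combinatorics where
  open import Data.Bool using (Bool; true; false; if_then_else_; _∧_; not)
  import Data.Bool.Properties as Bool
  open import Data.Empty using (⊥; ⊥-elim)
  open import Data.Fin as Fin using (Fin; zero; suc; toℕ)
  import Data.Fin.Properties as Fin
  open import Data.Fin.Subset as Subset using (Subset; Nonempty)
  open import Data.List using (List; []; _∷_; length; filter; map; concatMap; tabulate; allFin)
  open import Data.List.Membership.Propositional using (_∈_; lose)
  open import Data.List.Membership.Propositional.Properties using (∈-filter⁺; ∈-allFin; ∈-tabulate⁺; ∈-concatMap⁺)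
  open import Data.List.Properties using (length-++; length-map; length-tabulate)
  open import Data.List.Relation.Unary.All as All using (All)
  import Data.List.Relation.Unary.All.Properties as All
  open import Data.List.Relation.Unary.AllPairs as AllPairs using (AllPairs)
  import Data.List.Relation.Unary.AllPairs.Properties as AllPairs
  open import Data.List.Relation.Unary.Any using (here; there)
  open import Data.List.Relation.Unary.Unique.Propositional.Properties using (allFin⁺; filter⁺)
  import Data.Nat as ℕ
  open import Data.Nat using (ℕ; zero; suc; _+_; _*_; _∸_; _/_; _%_; _≤_; _<_; z≤n; s≤s; s≤s⁻¹; _≤?_; _<?_; _<ᵇ_)
  open import Data.Nat.DivMod using (m≡m%n+[m/n]*n; m%n<n; m/n*n≤m; /-monoˡ-≤)
  open import Data.Nat.Properties
  open import Data.Nat.Tactic.RingSolver using (solve-∀)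
  open import Data.Product using (Σ; ∃; _×_; _,_; proj₁; proj₂)
  open import Data.Sum using (_⊎_; inj₁; inj₂)
  open import Data.Vec as Vec using ()
  open import Data.Vec.Properties using (lookup∘tabulate; lookup⇒[]=; []=⇒lookup)
  open import Function using (_∘_; id)
  open import Level using (0ℓ)
  open import Relation.Binary.Definitions using (tri<; tri≈; tri>)
  open import Relation.Binary.PropositionalEquality as ≡ using (_≡_; _≢_; refl; cong; cong₂; subst; subst₂; trans)
  open import Relation.Nullary using (Dec; yes; no; does; ¬_; contradiction)
  open import Relation.Nullary.Decidable using (_×-dec_; _⊎-dec_; ¬?; dec-true)
  open import Relation.Unary using (Pred; Decidable)

  -- Counting in finite sets: indicator sums, averaging, fibres.

  module Counting where

    private variable
      k : ℕ
      A B C : Set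

    sumFin-mono : {f g : Fin k → ℕ} → (∀ i → f i ≤ g i) → sumFin f ≤ sumFin g
    sumFin-mono {zero}  le = z≤n
    sumFin-mono {suc k} le = +-mono-≤ (le zero) (sumFin-mono (le ∘ suc))

    sumFin-cong : {f g : Fin k → ℕ} → (∀ i → f i ≡ g i) → sumFin f ≡ sumFin g
    sumFin-cong {zero}  eq = refl
    sumFin-cong {suc k} eq = cong₂ _+_ (eq zero) (sumFin-cong (eq ∘ suc))

    sumFin-+ : (f g : Fin k → ℕ) → sumFin (λ i → f i + g i) ≡ sumFin f + sumFin g
    sumFin-+ {zero}  f g = refl
    sumFin-+ {suc k} f g rewrite sumFin-+ (f ∘ suc) (g ∘ suc) =
      interchange (f zero) (g zero) (sumFin (f ∘ suc)) (sumFin (g ∘ suc))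
      where
      interchange : ∀ a b c d → a + b + (c + d) ≡ a + c + (b + d)
      interchange = solve-∀

    sumFin-const : ∀ k c → sumFin {k} (λ _ → c) ≡ k * c
    sumFin-const zero    c = refl
    sumFin-const (suc k) c = cong (c +_) (sumFin-const k c)

    sumFin-swap : ∀ {m} (f : Fin k → Fin m → ℕ) →
      sumFin (λ i → sumFin (f i)) ≡ sumFin (λ j → sumFin (λ i → f i j))
    sumFin-swap {zero} {m} f = ≡.sym (trans (sumFin-const m 0) (*-zeroʳ m))
    sumFin-swap {suc k}    f rewrite sumFin-swap (f ∘ suc) =
      ≡.sym (sumFin-+ (f zero) (λ j → sumFin (λ i → f (suc i) j)))

    term≤sumFin : (f : Fin k → ℕ) (i : Fin k) → f i ≤ sumFin f
    term≤sumFin f zero    = m≤m+n _ _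
    term≤sumFin f (suc i) = ≤-trans (term≤sumFin (f ∘ suc) i) (m≤n+m _ (f zero))

    sumFin-averaging : ∀ {k} .{{_ : ℕ.NonZero k}} (f : Fin k → ℕ) → ∃ λ i → k * f i ≤ sumFin f
    sumFin-averaging {suc zero}    f = zero , ≤-refl
    sumFin-averaging {suc (suc k)} f with sumFin-averaging (f ∘ suc)
    ... | i , avg with ≤-total (f zero) (f (suc i))
    ... | inj₁ f0≤ = zero , +-monoʳ-≤ (f zero) (≤-trans (*-monoʳ-≤ (suc k) f0≤) avg)
    ... | inj₂ f0≥ = suc i , +-mono-≤ f0≥ avg

    -- The same conditional as in `count`, so that counting a decidable predicate agrees with
    -- `count` almost by computation.
    𝟙 : Dec A → ℕ
    𝟙 a = if does a then 1 else 0

    𝟙-mono : (a : Dec A) (b : Dec B) → (A → B) → 𝟙 a ≤ 𝟙 b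
    𝟙-mono (yes a) (yes b) f = ≤-refl
    𝟙-mono (yes a) (no ¬b) f = contradiction (f a) ¬b
    𝟙-mono (no ¬a) b       f = z≤n

    𝟙-yes : (a : Dec A) → A → 1 ≤ 𝟙 a
    𝟙-yes (yes _) _ = ≤-refl
    𝟙-yes (no ¬a) a = contradiction a ¬a

    𝟙-⊎ : (a : Dec A) (b : Dec B) (c : Dec C) → (A → B ⊎ C) → 𝟙 a ≤ 𝟙 b + 𝟙 c
    𝟙-⊎ (no _)  _ _ f = z≤n
    𝟙-⊎ (yes a) b c f with f a
    ... | inj₁ x = ≤-trans (𝟙-yes b x) (m≤m+n _ _)
    ... | inj₂ x = ≤-trans (𝟙-yes c x) (m≤n+m _ (𝟙 b))

    𝟙-disjoint : (a : Dec A) (b : Dec B) (c : Dec C) →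
      (A → C) → (B → C) → (A → B → ⊥) → 𝟙 a + 𝟙 b ≤ 𝟙 c
    𝟙-disjoint (yes a) (yes b) c f g h = ⊥-elim (h a b)
    𝟙-disjoint (yes a) (no _)  c f g h = 𝟙-yes c (f a)
    𝟙-disjoint (no _)  b       c f g h = 𝟙-mono b c g

    # : {P : Pred (Fin k) 0ℓ} → Decidable P → ℕ
    # P? = sumFin (λ i → 𝟙 (P? i))

    count≡# : {P : Pred (Fin k) 0ℓ} (P? : Decidable P) → count (λ i → does (P? i)) ≡ # P?
    count≡# {zero}  P? = refl
    count≡# {suc k} P? = cong (𝟙 (P? zero) +_) (count≡# (P? ∘ suc))

    private variable
      P Q R : Pred (Fin k) 0ℓ

    #-mono : (P? : Decidable P) (Q? : Decidable Q) → (∀ {i} → P i → Q i) → # P? ≤ # Q?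
    #-mono P? Q? f = sumFin-mono (λ i → 𝟙-mono (P? i) (Q? i) f)

    #-∪ : (P? : Decidable P) (Q? : Decidable Q) (R? : Decidable R) →
      (∀ {i} → P i → Q i ⊎ R i) → # P? ≤ # Q? + # R?
    #-∪ P? Q? R? f = ≤-trans (sumFin-mono (λ i → 𝟙-⊎ (P? i) (Q? i) (R? i) f))
      (≤-reflexive (sumFin-+ (λ i → 𝟙 (Q? i)) (λ i → 𝟙 (R? i))))

    #-disjoint : (P? : Decidable P) (Q? : Decidable Q) (R? : Decidable R) →
      (∀ {i} → P i → R i) → (∀ {i} → Q i → R i) → (∀ {i} → P i → Q i → ⊥) → # P? + # Q? ≤ # R?
    #-disjoint P? Q? R? f g h = ≤-trans
      (≤-reflexive (≡.sym (sumFin-+ (λ i → 𝟙 (P? i)) (λ i → 𝟙 (Q? i)))))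
      (sumFin-mono (λ i → 𝟙-disjoint (P? i) (Q? i) (R? i) f g h))

    #-nonempty : (P? : Decidable P) → ∀ {i} → P i → 1 ≤ # P?
    #-nonempty P? {i} p = ≤-trans (𝟙-yes (P? i) p) (term≤sumFin (λ j → 𝟙 (P? j)) i)

    #-⊂ : (P? : Decidable P) (Q? : Decidable Q) →
      (∀ {i} → P i → Q i) → ∀ {i} → Q i → ¬ P i → # P? < # Q?
    #-⊂ P? Q? f {i} q ¬p = ≤-trans
      (≤-trans (≤-reflexive (+-comm 1 _)) (+-monoʳ-≤ (# P?) (#-nonempty (Fin._≟ i) {i} refl)))
      (#-disjoint P? (Fin._≟ i) Q? f (λ { refl → q }) (λ { p refl → ¬p p }))

    𝟙-no : (a : Dec A) → ¬ A → 𝟙 a ≡ 0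
    𝟙-no (yes a) ¬a = contradiction a ¬a
    𝟙-no (no _)  _  = refl

    #-empty : (P? : Decidable {A = Fin k} P) → (∀ i → ¬ P i) → # P? ≡ 0
    #-empty {k} P? f =
      trans (sumFin-cong (λ i → 𝟙-no (P? i) (f i))) (trans (sumFin-const k 0) (*-zeroʳ k))

    #-total : (P? : Decidable {A = Fin k} P) → (∀ i → P i) → # P? ≡ k
    #-total {k} P? f = trans (sumFin-cong (λ i → one (P? i) (f i))) (trans (sumFin-const k 1) (*-identityʳ k))
      where
      one : (a : Dec A) → A → 𝟙 a ≡ 1
      one (yes _) _ = refl
      one (no ¬a) a = contradiction a ¬a

    #≤1 : (P? : Decidable {A = Fin k} P) → (∀ {i j} → P i → P j → i ≡ j) → # P? ≤ 1
    #≤1 {zero}  P? f = z≤n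
    #≤1 {suc k} P? f with P? zero
    ... | yes p = s≤s (≤-reflexive (#-empty (P? ∘ suc) λ i q → Fin.0≢1+n (f p q)))
    ... | no ¬p = #≤1 (P? ∘ suc) (λ p q → Fin.suc-injective (f p q))

    -- The fibre over the head of `xs` is split off; no remaining point maps to the head, so the
    -- tail covers the rest.
    #-fibres : ∀ {m} (P? : Decidable {A = Fin k} P) (f : Fin k → Fin m) (c : ℕ) (xs : List (Fin m)) →
      (∀ {i} → P i → f i ∈ xs) → (∀ x → # (λ i → P? i ×-dec (f i Fin.≟ x)) ≤ c) → # P? ≤ length xs * c
    #-fibres P? f c []       cover small = ≤-reflexive (#-empty P? λ i p → case[] (cover p))
      where
      case[] : ∀ {x} → ¬ (x ∈ [])
      case[] ()
    #-fibres {P = P} P? f c (x ∷ xs) cover small = ≤-trans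
      (#-∪ P? (λ i → P? i ×-dec (f i Fin.≟ x)) rest? split)
      (+-mono-≤ (small x) (#-fibres rest? f c xs cover′ small′))
      where
      rest? : Decidable (λ i → P i × f i ≢ x)
      rest? i = P? i ×-dec ¬? (f i Fin.≟ x)
      split : ∀ {i} → P i → (P i × f i ≡ x) ⊎ (P i × f i ≢ x)
      split {i} p with f i Fin.≟ x
      ... | yes eq = inj₁ (p , eq)
      ... | no neq = inj₂ (p , neq)
      cover′ : ∀ {i} → P i × f i ≢ x → f i ∈ xs
      cover′ (p , neq) with cover p
      ... | here eq = contradiction eq neq
      ... | there m = m
      small′ : ∀ y → # (λ i → rest? i ×-dec (f i Fin.≟ y)) ≤ c
      small′ y = ≤-trans (#-mono (λ i → rest? i ×-dec (f i Fin.≟ y)) (λ i → P? i ×-dec (f i Fin.≟ y))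
        (λ { ((p , _) , eq) → p , eq })) (small y)

    #≤length : (P? : Decidable {A = Fin k} P) (xs : List (Fin k)) → (∀ {i} → P i → i ∈ xs) → # P? ≤ length xs
    #≤length P? xs cover = ≤-trans
      (#-fibres P? id 1 xs cover (λ x → #≤1 (λ i → P? i ×-dec (i Fin.≟ x)) (λ { (_ , refl) (_ , refl) → refl })))
      (≤-reflexive (*-identityʳ _))

  -- Bounded walks and breadth-first layerings.

  module Walks (G : Graph) where
    open Counting

    V : Set
    V = Fin (n G)

    infix 4 _~_
    _~_ : V → V → Set
    u ~ v = adj G u v ≡ true

    _~?_ : ∀ u v → Dec (u ~ v)
    u ~? v = adj G u v Bool.≟ true

    ~-sym : ∀ {u v} → u ~ v → v ~ u
    ~-sym {u} {v} e = trans (sym G v u) e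

    ~-irrefl : ∀ {v} → ¬ (v ~ v)
    ~-irrefl {v} e with () ← trans (≡.sym e) (irrefl G v)

    -- The number only bounds the length of the walk from above, so that distances never have to be
    -- defined.
    data Near (U : Pred V 0ℓ) : ℕ → V → V → Set where
      stay : ∀ {r v} → Near U r v v
      move : ∀ {r u v w} → U u → U v → u ~ v → Near U r v w → Near U (suc r) u w

    private variable
      U U′ : Pred V 0ℓ
      r s : ℕ
      u v w : V

    near-mono : (∀ {x} → U x → U′ x) → r ≤ s → Near U r u v → Near U′ s u v
    near-mono f r≤s       stay           = stay
    near-mono f (s≤s r≤s) (move p q e p′) = move (f p) (f q) e (near-mono f r≤s p′)

    near-trans : Near U r u v → Near U s v w → Near U (r + s) u w
    near-trans {r = r} stay        q = near-mono id (m≤n+m _ r) q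
    near-trans (move x y e p) q = move x y e (near-trans p q)

    near-sym : Near U r u v → Near U r v u
    near-sym stay = stay
    near-sym {U = U} (move {r} {u} {w = w} x y e p) =
      subst (λ k → Near U k w u) (+-comm r 1) (near-trans (near-sym p) (move y x (~-sym e) stay))

    -- Breadth-first search described locally. The conditions force `level` to be the distance to
    -- the root inside `U`: along an edge it changes by at most one, and chains of parents realise
    -- it.
    record Layering (U : Pred V 0ℓ) : Set where
      field
        root  : V → V
        level : V → ℕ
        root-~  : U u → U v → u ~ v → root u ≡ root v
        level-~ : U u → U v → u ~ v → level v ≤ suc (level u)
        level-0 : U v → level v ≡ 0 → v ≡ root v
        parent  : U v → level v ≡ suc r → ∃ λ u → U u × u ~ v × level u ≡ r

      near-level : Near U r u v → level v ≤ r + level u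
      near-level {r = r} stay = m≤n+m _ r
      near-level (move {r} {u} {v} x y e p) = ≤-trans (near-level p)
        (≤-trans (+-monoʳ-≤ r (level-~ x y e)) (≤-reflexive (+-suc r (level u))))

      -- Every vertex is linked to its root by a chain of parents, so whatever passes along edges
      -- spreads from the root.
      root-induction : (P : Pred V 0ℓ) → (∀ {u v} → U u → U v → u ~ v → P u → P v) →
        U v → P (root v) → P v
      root-induction {v} P along = go _ refl
        where
        go : ∀ k {v} → level v ≡ k → U v → P (root v) → P v
        go zero    ℓ≡ Uv p = subst P (≡.sym (level-0 Uv ℓ≡)) p
        go (suc k) ℓ≡ Uv p with parent Uv ℓ≡
        ... | u , Uu , e , ℓu = along Uu Uv e (go k ℓu Uu (subst P (≡.sym (root-~ Uu Uv e)) p))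

      invariant : {A : Set} (f : V → A) → (∀ {u v} → U u → U v → u ~ v → f u ≡ f v) →
        U v → f v ≡ f (root v)
      invariant {v} f inv Uv = root-induction (λ x → f x ≡ f (root v)) (λ x y e eq → trans (≡.sym (inv x y e)) eq) Uv refl

    open Layering

    layering-resp : (∀ {v} → U v → U′ v) → (∀ {v} → U′ v → U v) → Layering U → Layering U′
    layering-resp f g L = record
      { root    = root L
      ; level   = level L
      ; root-~  = λ x y → root-~ L (g x) (g y)
      ; level-~ = λ x y → level-~ L (g x) (g y)
      ; level-0 = λ x → level-0 L (g x)
      ; parent  = λ x ℓ≡ → let u , Uu , e , ℓu = parent L (g x) ℓ≡ in u , f Uu , e , ℓu
      }

    -- All of `N` receives one root and one level, so edges inside `N` are harmless and only those
    -- between `P` and `N` need hypotheses. With `c` zero this opens a new component, with `c`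
    -- positive it adds the next layer.
    adjoin : {P N : Pred V 0ℓ} → Decidable P → (∀ {v} → N v → ¬ P v) → (L : Layering P) (x : V) (c : ℕ) →
      (∀ {u v} → P u → N v → u ~ v → root L u ≡ x × level L u ≤ suc c × c ≤ suc (level L u)) →
      (∀ {v k} → N v → c ≡ suc k → ∃ λ u → P u × u ~ v × level L u ≡ k) →
      (∀ {v} → N v → c ≡ 0 → v ≡ x) →
      Σ (Layering (λ v → P v ⊎ N v)) λ L′ →
        (∀ {v} → P v → root L′ v ≡ root L v × level L′ v ≡ level L v) ×
        (∀ {v} → N v → root L′ v ≡ x × level L′ v ≡ c)
    adjoin {P} {N} P? disj L x c joint up base = L′ , old , new
      where
      root′ : V → V
      root′ v = if does (P? v) then root L v else x
      level′ : V → ℕ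
      level′ v = if does (P? v) then level L v else c
      old : ∀ {v} → P v → root′ v ≡ root L v × level′ v ≡ level L v
      old {v} p with P? v
      ... | yes _ = refl , refl
      ... | no ¬p = contradiction p ¬p
      new : ∀ {v} → N v → root′ v ≡ x × level′ v ≡ c
      new {v} q with P? v
      ... | yes p = contradiction p (disj q)
      ... | no _  = refl , refl
      root-~′ : ∀ {u v} → P u ⊎ N u → P v ⊎ N v → u ~ v → root′ u ≡ root′ v
      root-~′ (inj₁ p) (inj₁ q) e rewrite proj₁ (old p) | proj₁ (old q) = root-~ L p q e
      root-~′ (inj₁ p) (inj₂ q) e rewrite proj₁ (old p) | proj₁ (new q) = proj₁ (joint p q e)
      root-~′ (inj₂ p) (inj₁ q) e rewrite proj₁ (new p) | proj₁ (old q) = ≡.sym (proj₁ (joint q p (~-sym e)))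
      root-~′ (inj₂ p) (inj₂ q) e rewrite proj₁ (new p) | proj₁ (new q) = refl
      level-~′ : ∀ {u v} → P u ⊎ N u → P v ⊎ N v → u ~ v → level′ v ≤ suc (level′ u)
      level-~′ (inj₁ p) (inj₁ q) e rewrite proj₂ (old p) | proj₂ (old q) = level-~ L p q e
      level-~′ (inj₁ p) (inj₂ q) e rewrite proj₂ (old p) | proj₂ (new q) = proj₂ (proj₂ (joint p q e))
      level-~′ (inj₂ p) (inj₁ q) e rewrite proj₂ (new p) | proj₂ (old q) = proj₁ (proj₂ (joint q p (~-sym e)))
      level-~′ (inj₂ p) (inj₂ q) e rewrite proj₂ (new p) | proj₂ (new q) = n≤1+n c
      level-0′ : ∀ {v} → P v ⊎ N v → level′ v ≡ 0 → v ≡ root′ v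
      level-0′ (inj₁ p) ℓ≡ = trans (level-0 L p (trans (≡.sym (proj₂ (old p))) ℓ≡)) (≡.sym (proj₁ (old p)))
      level-0′ (inj₂ q) ℓ≡ = trans (base q (trans (≡.sym (proj₂ (new q))) ℓ≡)) (≡.sym (proj₁ (new q)))
      parent′ : ∀ {v k} → P v ⊎ N v → level′ v ≡ suc k → ∃ λ u → (P u ⊎ N u) × u ~ v × level′ u ≡ k
      parent′ (inj₁ p) ℓ≡ with parent L p (trans (≡.sym (proj₂ (old p))) ℓ≡)
      ... | u , Pu , e , ℓu = u , inj₁ Pu , e , trans (proj₂ (old Pu)) ℓu
      parent′ (inj₂ q) ℓ≡ with up q (trans (≡.sym (proj₂ (new q))) ℓ≡)
      ... | u , Pu , e , ℓu = u , inj₁ Pu , e , trans (proj₂ (old Pu)) ℓu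
      L′ : Layering (λ v → P v ⊎ N v)
      L′ = record { root = root′ ; level = level′ ; root-~ = root-~′ ; level-~ = level-~′
                  ; level-0 = level-0′ ; parent = parent′ }

    module _ {U : Pred V 0ℓ} (U? : Decidable U) where

      Frontier : Pred V 0ℓ → V → Set
      Frontier P u = P u × ∃ λ w → U w × ¬ P w × u ~ w

      record Search (P : Pred V 0ℓ) : Set where
        field
          P?   : Decidable P
          P⊆U  : ∀ {v} → P v → U v
          lay  : Layering P
          -- All frontier vertices lie in the outermost layer of the component being explored.
          flat : Frontier P u → Frontier P v → root lay u ≡ root lay v × level lay u ≡ level lay v

      open Search

      -- As `N` contains every unvisited neighbour of `P`, no vertex of `P` stays on the frontier.
      -- The new frontier lies in the single layer `N`, which preserves `flat`.
      expand : ∀ {P N} (S : Search P) → Decidable N → (∀ {v} → N v → U v × ¬ P v) → (x : V) (c : ℕ) →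
        (∀ {u v} → P u → N v → u ~ v → root (lay S) u ≡ x × suc (level (lay S) u) ≡ c) →
        (∀ {v k} → N v → c ≡ suc k → ∃ λ u → P u × u ~ v) →
        (∀ {v} → N v → c ≡ 0 → v ≡ x) →
        (∀ {u v} → P u → U v → ¬ P v → u ~ v → N v) →
        Search (λ v → P v ⊎ N v)
      expand {P} {N} S N? N⊆ x c joint up base closed = record
        { P?   = λ v → P? S v ⊎-dec N? v
        ; P⊆U  = λ { (inj₁ p) → P⊆U S p ; (inj₂ q) → proj₁ (N⊆ q) }
        ; lay  = proj₁ L′
        ; flat = λ f g → trans (proj₁ (outer f)) (≡.sym (proj₁ (outer g)))
                       , trans (proj₂ (outer f)) (≡.sym (proj₂ (outer g)))
        }
        where
        L′ = adjoin (P? S) (proj₂ ∘ N⊆) (lay S) x c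
          (λ p q e → let a , b = joint p q e in
            a , ≤-trans (n≤1+n _) (≤-trans (≤-reflexive b) (n≤1+n c)) , ≤-reflexive (≡.sym b))
          (λ q c≡ → let u , Pu , e = up q c≡ in
            u , Pu , e , suc-injective (trans (proj₂ (joint Pu q e)) c≡))
          base
        outer : Frontier (λ v → P v ⊎ N v) v → root (proj₁ L′) v ≡ x × level (proj₁ L′) v ≡ c
        outer (inj₂ q , _) = proj₂ (proj₂ L′) q
        outer (inj₁ p , w , Uw , ¬w , e) = contradiction (inj₂ (closed p Uw (¬w ∘ inj₁) e)) ¬w

      -- Each round visits all unvisited neighbours of the visited set or, if there are none, one
      -- unvisited vertex as a new root. The fuel `k` exceeds the number of unvisited vertices,
      -- which drops every time.
      search : ∀ k {P} (S : Search P) → # (λ v → U? v ×-dec ¬? (P? S v)) < k → Layering U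
      search (suc k) {P} S (s≤s lt) with Fin.any? (λ w → U? w ×-dec ¬? (P? S w) ×-dec Fin.any? (λ u → P? S u ×-dec (u ~? w)))
      ... | yes (w , Uw , ¬Pw , u , Pu , e) = search k S′ (<-≤-trans shrink lt)
        where
        N = λ v → U v × ¬ P v × ∃ λ u → P u × u ~ v
        S′ = expand {N = N} S (λ w → U? w ×-dec ¬? (P? S w) ×-dec Fin.any? (λ u → P? S u ×-dec (u ~? w)))
          (λ q → proj₁ q , proj₁ (proj₂ q)) (root (lay S) u) (suc (level (lay S) u))
          (λ { p (Uv , ¬Pv , _) e′ → let a , b = flat S (p , _ , Uv , ¬Pv , e′) (Pu , w , Uw , ¬Pw , e) in a , cong suc b })
          (λ q _ → proj₂ (proj₂ q)) (λ _ ()) (λ p Uv ¬Pv e′ → Uv , ¬Pv , _ , p , e′)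
        shrink = #-⊂ (λ v → U? v ×-dec ¬? (P? S′ v)) (λ v → U? v ×-dec ¬? (P? S v))
          (λ (a , b) → a , b ∘ inj₁) {w} (Uw , ¬Pw) (λ (_ , b) → b (inj₂ (Uw , ¬Pw , u , Pu , e)))
      ... | no closed with Fin.any? (λ w → U? w ×-dec ¬? (P? S w))
      ... | yes (x , Ux , ¬Px) = search k S′ (<-≤-trans shrink lt)
        where
        S′ = expand {N = _≡ x} S (Fin._≟ x) (λ { refl → Ux , ¬Px }) x 0
          (λ { p refl e → contradiction (_ , Ux , ¬Px , _ , p , e) closed })
          (λ _ ()) (λ q _ → q) (λ p Uv ¬Pv e → contradiction (_ , Uv , ¬Pv , _ , p , e) closed)
        shrink = #-⊂ (λ v → U? v ×-dec ¬? (P? S′ v)) (λ v → U? v ×-dec ¬? (P? S v))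
          (λ (a , b) → a , b ∘ inj₁) {x} (Ux , ¬Px) (λ (_ , b) → b (inj₂ refl))
      ... | no none = layering-resp (P⊆U S) all (lay S)
        where
        all : ∀ {v} → U v → P v
        all {v} Uv with P? S v
        ... | yes p = p
        ... | no ¬p = contradiction (v , Uv , ¬p) none

      layering : Layering U
      layering = search _ {λ _ → ⊥} start ≤-refl
        where
        start : Search (λ _ → ⊥)
        start = record
          { P?   = λ _ → no λ ()
          ; P⊆U  = λ ()
          ; lay  = record { root = id ; level = λ _ → 0 ; root-~ = λ () ; level-~ = λ () ; level-0 = λ () ; parent = λ () }
          ; flat = λ ()
          }

  -- Removing every Δ-th layer, and the bands that are left.

  module Chopping (G : Graph) (Δ : ℕ) .{{_ : ℕ.NonZero Δ}} where
    open Counting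
    open Walks G
    open Layering

    private variable
      U : Pred V 0ℓ
      v w : V

    Cut : Layering U → ℕ → V → Set
    Cut L s v = (level L v + s) % Δ ≡ 0

    cut? : (L : Layering U) (s : ℕ) → Decidable (Cut L s)
    cut? L s v = (level L v + s) % Δ ℕ.≟ 0

    quotient-< : ∀ {x} → x % Δ ≢ 0 → x / Δ * Δ < x
    quotient-< {x} x≢ = ≤∧≢⇒< (m/n*n≤m x Δ)
      (λ eq → x≢ (m+n≡n⇒m≡0 (x % Δ) (trans (≡.sym (m≡m%n+[m/n]*n x Δ)) (≡.sym eq))))
      where
      m+n≡n⇒m≡0 : ∀ m {n} → m + n ≡ n → m ≡ 0
      m+n≡n⇒m≡0 m {n} eq = +-cancelʳ-≡ n m 0 eq

    <-quotient : ∀ x → x < suc (x / Δ) * Δ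
    <-quotient x = ≤-trans (≤-reflexive (cong suc (m≡m%n+[m/n]*n x Δ))) (+-monoˡ-≤ (x / Δ * Δ) (m%n<n x Δ))

    multiple : ∀ {x} → x % Δ ≡ 0 → x ≡ x / Δ * Δ
    multiple {x} x≡ = trans (m≡m%n+[m/n]*n x Δ) (cong (_+ x / Δ * Δ) x≡)

    -- Going up by one reaches a new quotient only at a multiple of Δ, and `y` is not one.
    quotient-≤ : ∀ {x y} → y % Δ ≢ 0 → y ≤ suc x → y / Δ ≤ x / Δ
    quotient-≤ {x} {y} y≢ y≤ = s≤s⁻¹ (*-cancelʳ-< Δ _ (suc (x / Δ))
      (<-≤-trans (quotient-< y≢) (≤-trans y≤ (<-quotient x))))

    -- Both `x + s` and `x + t` are multiples of Δ, so they differ by at least Δ.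
    cut-gap : ∀ x {s t} → s < t → (x + s) % Δ ≡ 0 → (x + t) % Δ ≡ 0 → Δ ≤ t
    cut-gap x {s} {t} s<t s∣ t∣ = +-cancelˡ-≤ x Δ t (begin
      x + Δ                      ≤⟨ +-monoˡ-≤ Δ (m≤m+n x s) ⟩
      (x + s) + Δ                ≡⟨ +-comm (x + s) Δ ⟩
      Δ + (x + s)                ≡⟨ cong (Δ +_) (multiple s∣) ⟩
      suc ((x + s) / Δ) * Δ      ≤⟨ *-monoˡ-≤ Δ (*-cancelʳ-< Δ ((x + s) / Δ) ((x + t) / Δ)
                                      (subst₂ _<_ (multiple s∣) (multiple t∣) (+-monoʳ-< x s<t))) ⟩
      (x + t) / Δ * Δ            ≤⟨ m/n*n≤m (x + t) Δ ⟩
      x + t                      ∎)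
      where open ≤-Reasoning

    cut-unique : ∀ x {s t} → s < Δ → t < Δ → (x + s) % Δ ≡ 0 → (x + t) % Δ ≡ 0 → s ≡ t
    cut-unique x {s} {t} s<Δ t<Δ s∣ t∣ with <-cmp s t
    ... | tri< s<t _ _ = contradiction t<Δ (≤⇒≯ (cut-gap x s<t s∣ t∣))
    ... | tri≈ _ s≡t _ = s≡t
    ... | tri> _ _ t<s = contradiction s<Δ (≤⇒≯ (cut-gap x t<s t∣ s∣))

    -- Among the Δ shifts at most one cuts a given vertex, so the cuts have total size at most `n G`
    -- and some shift does no worse than the average.
    sparse-cut : (U? : Decidable U) (L : Layering U) →
      ∃ λ s → Δ * # (λ v → U? v ×-dec cut? L s v) ≤ n G
    sparse-cut {U} U? L = toℕ (proj₁ avg) , ≤-trans (proj₂ avg) (begin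
      sumFin (λ s → sumFin (λ v → 𝟙 (hit? s v)))  ≡⟨ sumFin-swap (λ s v → 𝟙 (hit? s v)) ⟩
      sumFin (λ v → # (λ s → hit? s v))           ≤⟨ sumFin-mono (λ v → #≤1 (λ s → hit? s v)
        (λ {s} {t} (_ , a) (_ , b) → Fin.toℕ-injective (cut-unique (level L v) (Fin.toℕ<n s) (Fin.toℕ<n t) a b))) ⟩
      sumFin {n G} (λ _ → 1)                      ≡⟨ trans (sumFin-const (n G) 1) (*-identityʳ (n G)) ⟩
      n G                                         ∎)
      where
      open ≤-Reasoning
      hit? : (s : Fin Δ) (v : V) → Dec (U v × Cut L (toℕ s) v)
      hit? s v = U? v ×-dec cut? L (toℕ s) v
      avg = sumFin-averaging (λ s → # (hit? s))

    Chopped : Layering U → ℕ → Pred V 0ℓ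
    Chopped {U} L s v = U v × ¬ Cut L s v

    -- `filled` speaks of all of `U`, not only of the piece: a path that descends in `L` then meets
    -- no cut layer before it passes below `low`.
    record Band (L : Layering U) {U′ : Pred V 0ℓ} (L′ : Layering U′) (ρ : V) : Set where
      field
        low    : ℕ
        low≤   : U′ v → root L′ v ≡ ρ → low ≤ level L v
        <high  : U′ v → root L′ v ≡ ρ → level L v < low + Δ
        filled : U′ v → root L′ v ≡ ρ → U w → low ≤ level L w → level L w ≤ level L v → U′ w

    -- The quotient of the shifted level by Δ is constant on a piece, since a walk could change it
    -- only by stepping on a cut layer.
    band : (L : Layering U) (s : ℕ) (L′ : Layering (Chopped L s)) (ρ : V) → Band L L′ ρ
    band {U} L s L′ ρ = record { low = low ; low≤ = low≤ ; <high = <high ; filled = filled }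
      where
      q : V → ℕ
      q v = (level L v + s) / Δ
      q-step : ∀ {u v} → Chopped L s u → Chopped L s v → u ~ v → q v ≤ q u
      q-step (Uu , _) (Uv , ¬cut) e = quotient-≤ ¬cut (+-monoˡ-≤ s (level-~ L Uu Uv e))
      q≡ : ∀ {v} → Chopped L s v → root L′ v ≡ ρ → q v ≡ q ρ
      q≡ p refl = invariant L′ q (λ a b e → ≤-antisym (q-step b a (~-sym e)) (q-step a b e)) p
      -- One level above the cut below the band; truncated subtraction makes it 0 if there is no
      -- such cut.
      low : ℕ
      low = suc (q ρ * Δ) ∸ s
      below : ∀ {v} → Chopped L s v → root L′ v ≡ ρ → level L v + s < suc (q ρ) * Δ
      below p eq = subst (λ k → _ < suc k * Δ) (q≡ p eq) (<-quotient _)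
      low≤ : ∀ {v} → Chopped L s v → root L′ v ≡ ρ → low ≤ level L v
      low≤ {v} p eq = m≤n+o⇒m∸n≤o _ s (subst₂ _≤_ (cong (λ k → suc (k * Δ)) (q≡ p eq)) (+-comm (level L v) s) (quotient-< (proj₂ p)))
      <high : ∀ {v} → Chopped L s v → root L′ v ≡ ρ → level L v < low + Δ
      <high {v} p eq = +-cancelʳ-< s (level L v) (low + Δ) (begin-strict
        level L v + s        <⟨ below p eq ⟩
        Δ + q ρ * Δ          ≤⟨ +-monoʳ-≤ Δ (≤-trans (n≤1+n _) (m≤n+m∸n (suc (q ρ * Δ)) s)) ⟩
        Δ + (s + low)        ≡⟨ rearrange Δ s low ⟩
        low + Δ + s          ∎)
        where
        open ≤-Reasoning
        rearrange : ∀ a b c → a + (b + c) ≡ c + a + b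
        rearrange = solve-∀
      filled : ∀ {v w} → Chopped L s v → root L′ v ≡ ρ → U w → low ≤ level L w → level L w ≤ level L v → Chopped L s w
      -- If `w` were cut, its shifted level would be a multiple of Δ beyond `q ρ * Δ`, yet no higher
      -- than the shifted level of `v`, whose quotient is still `q ρ`.
      filled {v} {w} p eq Uw lo hi = Uw , λ cut → <-irrefl refl (begin-strict
        q ρ         <⟨ *-cancelʳ-< Δ (q ρ) (q w) (begin-strict
                         q ρ * Δ             <⟨ m≤n+m∸n (suc (q ρ * Δ)) s ⟩
                         s + low             ≤⟨ +-monoʳ-≤ s lo ⟩
                         s + level L w       ≡⟨ +-comm s _ ⟩
                         level L w + s       ≡⟨ multiple cut ⟩
                         q w * Δ             ∎) ⟩
        q w         ≤⟨ /-monoˡ-≤ Δ (+-monoˡ-≤ s hi) ⟩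
        q v         ≡⟨ q≡ p eq ⟩
        q ρ         ∎)
        where open ≤-Reasoning

  -- Descending paths, and connected sets enlarged along them.

  module Descent (G : Graph) where
    open Counting
    open Walks G
    open Layering

    data Walk (P : Pred V 0ℓ) : V → V → Set where
      halt : ∀ {v} → P v → Walk P v v
      move : ∀ {u v w} → P u → u ~ v → Walk P v w → Walk P u w

    private variable
      P Q U U′ : Pred V 0ℓ
      u v w : V
      r : ℕ

    walk-mono : (∀ {x} → P x → Q x) → Walk P u v → Walk Q u v
    walk-mono f (halt p)     = halt (f p)
    walk-mono f (move p e q) = move (f p) e (walk-mono f q)

    walk-trans : Walk P u v → Walk P v w → Walk P u w
    walk-trans (halt _)     q = q
    walk-trans (move x e p) q = move x e (walk-trans p q)

    walk-start : Walk P u v → P u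
    walk-start (halt p)     = p
    walk-start (move p _ _) = p

    walk-sym : Walk P u v → Walk P v u
    walk-sym (halt p)     = halt p
    walk-sym (move p e q) = walk-trans (walk-sym q) (move (walk-start q) (~-sym e) (halt p))

    data Descends (L : Layering U) : V → V → Set where
      stop : Descends L v v
      down : U u → U v → u ~ v → level L v ≡ suc (level L u) → Descends L u w → Descends L v w

    module _ {L : Layering U} where

      descends-trans : Descends L u v → Descends L v w → Descends L u w
      descends-trans stop           q = q
      descends-trans (down x y e l p) q = down x y e l (descends-trans p q)

      descends-level : Descends L v w → level L w ≤ level L v
      descends-level stop = ≤-refl
      descends-level (down x y e l p) = ≤-trans (descends-level p) (≤-trans (n≤1+n _) (≤-reflexive (≡.sym l)))

      descends-root : U v → Descends L v w → U w × root L w ≡ root L v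
      descends-root Uv stop = Uv , refl
      descends-root Uv (down x y e l p) with descends-root x p
      ... | Uw , eq = Uw , trans eq (root-~ L x y e)

      descends-near : Descends L v w → level L v ≤ r + level L w → Near U r v w
      descends-near stop _ = stay
      descends-near {r = zero}  (down x y e l p) h =
        contradiction (≤-trans (≤-reflexive (≡.sym l)) (≤-trans h (descends-level p))) (<-irrefl refl)
      descends-near {r = suc r} (down x y e l p) h =
        move y x (~-sym e) (descends-near p (s≤s⁻¹ (≤-trans (≤-reflexive (≡.sym l)) h)))

      -- A descending path starting in a band leaves the chopped component only through the bottom of the band.
      descends-band : ∀ {Δ} .{{_ : ℕ.NonZero Δ}} {L′ : Layering U′} {ρ} (b : Chopping.Band G Δ L L′ ρ) →
        U′ v → root L′ v ≡ ρ → Descends L v w → Chopping.Band.low b ≤ level L w →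
        level L v ≤ r + level L w → Near U′ r v w × U′ w × root L′ w ≡ ρ
      descends-band b p eq stop _ _ = stay , p , eq
      descends-band {r = zero} b p eq (down x y e l d) lo h =
        contradiction (≤-trans (≤-reflexive (≡.sym l)) (≤-trans h (descends-level d))) (<-irrefl refl)
      descends-band {r = suc r} {Δ} {L′ = L′} b p eq (down {u} x y e l d) lo h =
        let q = filled p eq x (≤-trans lo (descends-level d)) (≤-trans (n≤1+n _) (≤-reflexive (≡.sym l)))
            N , z , eq′ = descends-band b q (trans (root-~ L′ q p e) eq) d lo (s≤s⁻¹ (≤-trans (≤-reflexive (≡.sym l)) h))
        in move p q (~-sym e) N , z , eq′
        where open Chopping.Band b

    -- Connectedness as walks to one fixed centre: gluing on a path keeps the centre.
    Conn : Pred V 0ℓ → V → Set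
    Conn P c = ∀ {v} → P v → Walk P v c

    -- Adds to `C` a chain of parents from `v` down to level `b`. Every added vertex remembers that
    -- it descends from `v`, which later controls its level, its root and its distance.
    record Extension (L : Layering U) (C : Pred V 0ℓ) (v : V) (b : ℕ) : Set₁ where
      field
        C′        : Pred V 0ℓ
        C′?       : Decidable C′
        C⊆C′      : C w → C′ w
        within    : C′ w → C w ⊎ (Descends L v w × b ≤ level L w)
        conn      : ∀ {c} → Conn C c → Conn C′ c
        end       : V
        end∈      : C′ end
        end-level : level L end ≡ b
        end-desc  : Descends L v end

    abstract
      extend : (L : Layering U) {C : Pred V 0ℓ} → Decidable C → ∀ s {b} → U v → C v → level L v ≡ s + b → Extension L C v b
      extend {v = v} L {C} C? zero {b} Uv Cv ℓ≡ = record
        { C′ = C ; C′? = C? ; C⊆C′ = id ; within = inj₁ ; conn = id ; end = v ; end∈ = Cv ; end-level = ℓ≡ ; end-desc = stop }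
      extend {U = U} {v = v} L {C} C? (suc s) {b} Uv Cv ℓ≡ with parent L Uv ℓ≡
      ... | p , Up , e , ℓp = record
        { C′ = C′ ; C′? = C′? ; C⊆C′ = C⊆C′ ∘ inj₁ ; within = inside ; conn = λ c → conn (conn₁ c)
        ; end = end ; end∈ = end∈ ; end-level = end-level ; end-desc = d end-desc }
        where
        C₁ : Pred V 0ℓ
        C₁ w = C w ⊎ w ≡ p
        open Extension (extend L {C₁} (λ w → C? w ⊎-dec (w Fin.≟ p)) s {b} Up (inj₂ refl) ℓp)
        d : ∀ {w} → Descends L p w → Descends L v w
        d = down Up Uv e (trans ℓ≡ (cong suc (≡.sym ℓp)))
        inside : ∀ {w} → C′ w → C w ⊎ (Descends L v w × b ≤ level L w)
        inside q with within q
        ... | inj₁ (inj₁ c)    = inj₁ c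
        ... | inj₁ (inj₂ refl) = inj₂ (d stop , ≤-trans (m≤n+m b s) (≤-reflexive (≡.sym ℓp)))
        ... | inj₂ (x , y)     = inj₂ (d x , y)
        conn₁ : ∀ {c} → Conn C c → Conn C₁ c
        conn₁ f (inj₁ q)    = walk-mono inj₁ (f q)
        conn₁ f (inj₂ refl) = move (inj₂ refl) e (walk-mono inj₁ (f Cv))

  -- Lifting a complete bipartite minor through one layering.

  module Minors (G : Graph) (U₀ : Pred (Fin (n G)) 0ℓ) (Δ : ℕ) .{{_ : ℕ.NonZero Δ}} {m : ℕ} (u : Fin m → Fin (n G)) where
    open Counting
    open Walks G
    open Layering
    open Descent G
    open Chopping G Δ

    Spread : ℕ → Set
    Spread R = ∀ {i j} → i ≢ j → ¬ Near U₀ R (u i) (u j)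

    -- A K_{m,k} minor: the columns C stay near the far-apart vertices u, and every column has a tip that is far,
    -- within U, from all the k sets T.
    record Grid {U : Pred V 0ℓ} (L : Layering U) (ρ : V) (k d : ℕ) : Set₁ where
      field
        C      : Fin m → Pred V 0ℓ
        C?     : ∀ j → Decidable (C j)
        C⊆     : ∀ {j w} → C j w → U w × root L w ≡ ρ
        C-near : ∀ {j w} → C j w → Near U₀ d (u j) w
        C-conn : ∀ j → Conn (C j) (u j)
        T      : Fin k → Pred V 0ℓ
        T?     : ∀ i → Decidable (T i)
        T⊆     : ∀ {i w} → T i w → U w × root L w ≡ ρ
        T-conn : ∀ i → ∃ λ c → Conn (T i) c
        TT     : ∀ {i i′ w} → i ≢ i′ → T i w → ¬ T i′ w
        CT     : ∀ {j i w} → C j w → ¬ T i w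
        C~T    : ∀ j i → ∃ λ x → ∃ λ y → C j x × T i y × x ~ y
        tip    : Fin m → V
        tip∈   : ∀ j → C j (tip j)
        far    : ∀ {j i w} → T i w → ¬ Near U Δ (tip j) w

    module _ {U U′ : Pred V 0ℓ} (U? : Decidable U) (U′⊆U : ∀ {v} → U′ v → U v) (U⊆U₀ : ∀ {v} → U v → U₀ v)
      (L : Layering U) (L′ : Layering U′) (ρ : V) (b : Band L L′ ρ) {k d : ℕ} (g : Grid L′ ρ k d) where

      open Band b
      open Grid g

      private
        ρ₀ : V
        ρ₀ = root L ρ

        root≡ : ∀ {w} → U′ w × root L′ w ≡ ρ → root L w ≡ ρ₀
        root≡ (p , refl) = invariant L′ (root L) (λ x y e → root-~ L (U′⊆U x) (U′⊆U y) e) p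

      -- The new row is the ball of levels up to `e`, and the columns are prolonged down to level
      -- `e + 1`. The new tip is put at level `Δ + e + 1`: more than Δ levels above the ball and,
      -- the band starting at `e + 2 + 2Δ`, more than Δ levels below all older rows. Levels change
      -- by at most one per edge, so the tip is far from every row.
      lift-grid : ∀ e → low ≡ suc (suc e) + Δ + Δ → Grid L ρ₀ (suc k) (d + 3 * Δ)
      lift-grid e low≡ = record
        { C = C⁺ ; C? = λ j → Extension.C′? (E₂ j) ; C⊆ = C⁺⊆ ; C-near = C⁺-near ; C-conn = C⁺-conn
        ; T = T⁺ ; T? = T⁺? ; T⊆ = λ {i} → T⁺⊆ {i} ; T-conn = T⁺-conn ; TT = λ {i} {i′} → TT⁺ {i} {i′}
        ; CT = λ {j} {i} → CT⁺ {j} {i} ; C~T = C~T⁺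
        ; tip = tip⁺ ; tip∈ = λ j → Extension.C⊆C′ (E₂ j) (Extension.end∈ (E₁ j)) ; far = λ {j} {i} → far⁺ {j} {i} }
        where
        Utip : ∀ j → U (tip j)
        Utip j = U′⊆U (proj₁ (C⊆ (tip∈ j)))

        tip-low : ∀ j → suc (suc e) + Δ + Δ ≤ level L (tip j)
        tip-low j = ≤-trans (≤-reflexive (≡.sym low≡)) (low≤ (proj₁ (C⊆ (tip∈ j))) (proj₂ (C⊆ (tip∈ j))))

        -- A path from here to a level of at least `e + 1` has at most `3 * Δ` steps; this is what
        -- one lift adds to the reach `d` of a column.
        tip-high : ∀ j → level L (tip j) ≤ 3 * Δ + suc e
        tip-high j = s≤s⁻¹ (≤-trans (<high (proj₁ (C⊆ (tip∈ j))) (proj₂ (C⊆ (tip∈ j))))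
          (≤-reflexive (trans (cong (_+ Δ) low≡) (rearrange e Δ))))
          where
          rearrange : ∀ e Δ → suc (suc e) + Δ + Δ + Δ ≡ suc (3 * Δ + suc e)
          rearrange = solve-∀

        E₁ : ∀ j → Extension L (C j) (tip j) (Δ + suc e)
        E₁ j = extend L (C? j) (level L (tip j) ∸ (Δ + suc e)) (Utip j) (tip∈ j)
          (≡.sym (m∸n+n≡m (≤-trans (≤-trans (m≤m+n (Δ + suc e) (suc Δ)) (≤-reflexive (rearrange e Δ))) (tip-low j))))
          where
          rearrange : ∀ e Δ → Δ + suc e + suc Δ ≡ suc (suc e) + Δ + Δ
          rearrange = solve-∀

        tip⁺ : Fin m → V
        tip⁺ j = Extension.end (E₁ j)

        U-tip⁺ : ∀ j → U (tip⁺ j)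
        U-tip⁺ j = proj₁ (descends-root (Utip j) (Extension.end-desc (E₁ j)))

        E₂ : ∀ j → Extension L (Extension.C′ (E₁ j)) (tip⁺ j) (suc e)
        E₂ j = extend L (Extension.C′? (E₁ j)) Δ (U-tip⁺ j) (Extension.end∈ (E₁ j)) (Extension.end-level (E₁ j))

        C⁺ : Fin m → Pred V 0ℓ
        C⁺ j = Extension.C′ (E₂ j)

        C⊆C⁺ : ∀ {j w} → C j w → C⁺ j w
        C⊆C⁺ {j} = Extension.C⊆C′ (E₂ j) ∘ Extension.C⊆C′ (E₁ j)

        path : ∀ {j w} → C⁺ j w → C j w ⊎ (Descends L (tip j) w × suc e ≤ level L w)
        path {j} p with Extension.within (E₂ j) p
        ... | inj₂ (x , y) = inj₂ (descends-trans (Extension.end-desc (E₁ j)) x , y)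
        ... | inj₁ q with Extension.within (E₁ j) q
        ... | inj₁ c = inj₁ c
        ... | inj₂ (x , y) = inj₂ (x , ≤-trans (m≤n+m (suc e) Δ) y)

        C⁺⊆ : ∀ {j w} → C⁺ j w → U w × root L w ≡ ρ₀
        C⁺⊆ {j} p with path p
        ... | inj₁ c = U′⊆U (proj₁ (C⊆ c)) , root≡ (C⊆ c)
        ... | inj₂ (x , _) with descends-root (Utip j) x
        ... | Uw , eq = Uw , trans eq (root≡ (C⊆ (tip∈ j)))

        C⁺-near : ∀ {j w} → C⁺ j w → Near U₀ (d + 3 * Δ) (u j) w
        C⁺-near {j} p with path p
        ... | inj₁ c = near-mono id (m≤m+n d _) (C-near c)
        ... | inj₂ (x , y) = near-trans (C-near (tip∈ j))
          (near-mono U⊆U₀ ≤-refl (descends-near x (≤-trans (tip-high j) (+-monoʳ-≤ (3 * Δ) y))))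

        C⁺-conn : ∀ j → Conn (C⁺ j) (u j)
        C⁺-conn j = Extension.conn (E₂ j) (Extension.conn (E₁ j) (C-conn j))

        T⁺ : Fin (suc k) → Pred V 0ℓ
        T⁺ zero    w = U w × root L w ≡ ρ₀ × level L w ≤ e
        T⁺ (suc i) w = T i w

        T⁺? : ∀ i → Decidable (T⁺ i)
        T⁺? zero    w = U? w ×-dec (root L w Fin.≟ ρ₀) ×-dec (level L w ≤? e)
        T⁺? (suc i) w = T? i w

        T⁺⊆ : ∀ {i w} → T⁺ i w → U w × root L w ≡ ρ₀
        T⁺⊆ {zero}  (a , b , _) = a , b
        T⁺⊆ {suc i} t = U′⊆U (proj₁ (T⊆ t)) , root≡ (T⊆ t)

        ball-conn : ∀ ℓ {w} → level L w ≡ ℓ → T⁺ zero w → Walk (T⁺ zero) w ρ₀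
        ball-conn zero    ℓ≡ t@(Uw , eq , _) = subst (Walk (T⁺ zero) _) (trans (level-0 L Uw ℓ≡) eq) (halt t)
        ball-conn (suc ℓ) ℓ≡ t@(Uw , eq , le) with parent L Uw ℓ≡
        ... | p , Up , a , ℓp = move t (~-sym a) (ball-conn ℓ ℓp
          (Up , trans (root-~ L Up Uw a) eq , ≤-trans (≤-reflexive ℓp) (≤-trans (n≤1+n ℓ) (≤-trans (≤-reflexive (≡.sym ℓ≡)) le))))

        T⁺-conn : ∀ i → ∃ λ c → Conn (T⁺ i) c
        T⁺-conn zero    = ρ₀ , ball-conn _ refl
        T⁺-conn (suc i) = T-conn i

        T-low : ∀ {i w} → T i w → suc (suc e) + Δ + Δ ≤ level L w
        T-low t = ≤-trans (≤-reflexive (≡.sym low≡)) (low≤ (proj₁ (T⊆ t)) (proj₂ (T⊆ t)))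

        low>e : suc e ≤ suc (suc e) + Δ + Δ
        low>e = ≤-trans (n≤1+n (suc e)) (≤-trans (m≤m+n _ Δ) (m≤m+n _ Δ))

        ball-T : ∀ {i w} → T⁺ zero w → ¬ T i w
        ball-T (_ , _ , le) t = <-irrefl refl (≤-trans (s≤s le) (≤-trans low>e (T-low t)))

        TT⁺ : ∀ {i i′ w} → i ≢ i′ → T⁺ i w → ¬ T⁺ i′ w
        TT⁺ {zero}  {zero}   neq _ _ = neq refl
        TT⁺ {zero}  {suc i′} neq t t′ = ball-T t t′
        TT⁺ {suc i} {zero}   neq t t′ = ball-T t′ t
        TT⁺ {suc i} {suc i′} neq t t′ = TT (neq ∘ cong suc) t t′

        CT⁺ : ∀ {j i w} → C⁺ j w → ¬ T⁺ i w
        CT⁺ {j} {zero} p (_ , _ , le) with path p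
        ... | inj₁ c = <-irrefl refl (≤-trans (s≤s le) (≤-trans low>e
          (≤-trans (≤-reflexive (≡.sym low≡)) (low≤ (proj₁ (C⊆ c)) (proj₂ (C⊆ c))))))
        ... | inj₂ (_ , y) = <-irrefl refl (≤-trans (s≤s le) y)
        CT⁺ {j} {suc i} p t with path p
        ... | inj₁ c = CT c t
        -- Where the new path meets an older row it is still in the band. It has thus stayed inside
        -- `U′` and made at most Δ steps from the old tip, against `far`.
        ... | inj₂ (x , _) = far t (proj₁ (descends-band b (proj₁ (C⊆ (tip∈ j))) (proj₂ (C⊆ (tip∈ j))) x
          (low≤ (proj₁ (T⊆ t)) (proj₂ (T⊆ t)))
          (≤-trans (<⇒≤ (<high (proj₁ (C⊆ (tip∈ j))) (proj₂ (C⊆ (tip∈ j)))))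
            (≤-trans (≤-reflexive (+-comm low Δ)) (+-monoʳ-≤ Δ (low≤ (proj₁ (T⊆ t)) (proj₂ (T⊆ t))))))))

        C~T⁺ : ∀ j i → ∃ λ x → ∃ λ y → C⁺ j x × T⁺ i y × x ~ y
        C~T⁺ j zero =
          let z∈ = Extension.end∈ (E₂ j)
              Uz , eq = C⁺⊆ z∈
              y , Uy , a , ℓy = parent L Uz (Extension.end-level (E₂ j))
          in _ , y , z∈ , (Uy , trans (root-~ L Uy Uz a) eq , ≤-reflexive ℓy) , ~-sym a
        C~T⁺ j (suc i) with C~T j i
        ... | x , y , c , t , a = x , y , C⊆C⁺ c , t , a

        far⁺ : ∀ {j i w} → T⁺ i w → ¬ Near U Δ (tip⁺ j) w
        far⁺ {j} {zero} (_ , _ , le) N = <-irrefl refl (begin-strict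
          level L (tip⁺ j)      ≤⟨ near-level L (near-sym N) ⟩
          Δ + level L _         <⟨ +-monoʳ-< Δ (s≤s le) ⟩
          Δ + suc e             ≡⟨ Extension.end-level (E₁ j) ⟨
          level L (tip⁺ j)      ∎)
          where open ≤-Reasoning
        far⁺ {j} {suc i} {w} t N = <-irrefl refl (begin-strict
          level L w             ≤⟨ near-level L N ⟩
          Δ + level L (tip⁺ j)  ≡⟨ cong (Δ +_) (Extension.end-level (E₁ j)) ⟩
          Δ + (Δ + suc e)       <⟨ ≤-reflexive (rearrange e Δ) ⟩
          suc (suc e) + Δ + Δ   ≤⟨ T-low t ⟩
          level L w             ∎)
          where
          open ≤-Reasoning
          rearrange : ∀ e Δ → suc (Δ + (Δ + suc e)) ≡ suc (suc e) + Δ + Δ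
          rearrange = solve-∀

      -- A band close to the root would bring all columns close to each other.
      low-band : ∀ {R} → Spread R → (d + 3 * Δ) + (3 * Δ + d) ≤ R → low ≤ suc (Δ + Δ) → ∀ {i j} → i ≡ j
      low-band {R} sp R≥ lo {i} {j} with i Fin.≟ j
      ... | yes eq = eq
      ... | no neq = contradiction (near-mono id R≥ (near-trans (via i) (near-sym′ (via j)))) (sp neq)
        where
        tip-level : ∀ j → level L (tip j) ≤ 3 * Δ
        tip-level j = s≤s⁻¹ (≤-trans (<high (proj₁ (C⊆ (tip∈ j))) (proj₂ (C⊆ (tip∈ j))))
          (≤-trans (+-monoˡ-≤ Δ lo) (≤-reflexive (rearrange Δ))))
          where
          rearrange : ∀ Δ → suc (Δ + Δ) + Δ ≡ suc (3 * Δ)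
          rearrange = solve-∀
        to-root : ∀ ℓ {w} → level L w ≡ ℓ → U w → Near U ℓ w (root L w)
        to-root zero    ℓ≡ Uw = subst (Near U 0 _) (level-0 L Uw ℓ≡) stay
        to-root (suc ℓ) ℓ≡ Uw with parent L Uw ℓ≡
        ... | p , Up , a , ℓp = move Uw Up (~-sym a) (subst (Near U ℓ p) (root-~ L Up Uw a) (to-root ℓ ℓp Up))
        via : ∀ j → Near U₀ (d + 3 * Δ) (u j) ρ₀
        via j = near-trans (C-near (tip∈ j)) (subst (Near U₀ (3 * Δ) (tip j)) (root≡ (C⊆ (tip∈ j)))
          (near-mono U⊆U₀ (tip-level j) (to-root _ refl (U′⊆U (proj₁ (C⊆ (tip∈ j)))))))
        near-sym′ : Near U₀ (d + 3 * Δ) (u j) ρ₀ → Near U₀ (3 * Δ + d) ρ₀ (u j)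
        near-sym′ N = near-mono id (≤-reflexive (+-comm d (3 * Δ))) (near-sym N)

  -- Decidable predicates as subsets.

  module Subsets where

    private variable
      k : ℕ
      P : Pred (Fin k) 0ℓ

    subset : Decidable {A = Fin k} P → Subset k
    subset P? = Vec.tabulate (λ i → does (P? i))

    ∈-subset⁺ : (P? : Decidable {A = Fin k} P) → ∀ {i} → P i → i Subset.∈ subset P?
    ∈-subset⁺ P? {i} p = lookup⇒[]= i _ (trans (lookup∘tabulate _ i) (dec-true (P? i) p))

    ∈-subset⁻ : (P? : Decidable {A = Fin k} P) → ∀ {i} → i Subset.∈ subset P? → P i
    ∈-subset⁻ P? {i} i∈ with P? i | trans (≡.sym (lookup∘tabulate (λ j → does (P? j)) i)) ([]=⇒lookup i∈)
    ... | yes p | _ = p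
    ... | no _  | ()

  -- Repeated cutting, and the minor found in a wide piece.

  module Fragments (G : Graph) (U₀ : Pred (Fin (n G)) 0ℓ) (Δ : ℕ) .{{_ : ℕ.NonZero Δ}} where
    open Counting
    open Subsets
    open Walks G
    open Layering
    open Descent G
    open Chopping G Δ
    open Minors G U₀ Δ

    private variable
      U : Pred V 0ℓ

    point-grid : ∀ {m} (u : Fin m → V) (L : Layering U) (ρ : V) →
      (∀ j → U (u j) × root L (u j) ≡ ρ) → ∀ {R} → Spread u R → Grid u L ρ 0 0
    point-grid {U} u L ρ u∈ sp = record
      { C = λ j w → w ≡ u j ; C? = λ j w → w Fin.≟ u j ; C⊆ = λ { {j} refl → u∈ j } ; C-near = λ { refl → stay }
      ; C-conn = λ { j refl → halt refl }
      ; T = λ () ; T? = λ () ; T⊆ = λ { {()} } ; T-conn = λ () ; TT = λ { {()} } ; CT = λ { {_} {()} } ; C~T = λ _ ()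
      ; tip = u ; tip∈ = λ _ → refl ; far = λ { {_} {()} } }

    -- `U′` and `L′` are what is left after all `k` cuts, whereas `grid` carries points of one final
    -- piece back to a minor over the outermost layering `L`, with one row per cut. At least two
    -- points are required because a band near the root is refuted by two points being too close to
    -- each other.
    record Pieces (U? : Decidable U) (L : Layering U) (k : ℕ) : Set₁ where
      field
        U′   : Pred V 0ℓ
        U′?  : Decidable U′
        L′   : Layering U′
        U′⊆U : ∀ {v} → U′ v → U v
        loss : Δ * # (λ v → ¬? (U′? v)) ≤ Δ * # (λ v → ¬? (U? v)) + k * n G
        grid : ∀ {m} (u : Fin (suc (suc m)) → V) {ρ} → (∀ j → U′ (u j) × root L′ (u j) ≡ ρ) →
          ∀ {R} → Spread u R → k * (3 * Δ) + k * (3 * Δ) ≤ R → ∃ λ ρ′ → Grid u L ρ′ k (k * (3 * Δ))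

    pieces : ∀ k (U? : Decidable U) (L : Layering U) → (∀ {v} → U v → U₀ v) → Pieces U? L k
    pieces zero U? L U⊆U₀ = record
      { U′ = _ ; U′? = U? ; L′ = L ; U′⊆U = id ; loss = m≤m+n _ 0 ; grid = λ u u∈ sp _ → _ , point-grid u L _ u∈ sp }
    pieces {U} (suc k) U? L U⊆U₀ = record
      { U′ = U′ ; U′? = U′? ; L′ = L′ ; U′⊆U = proj₁ ∘ U′⊆U ; loss = loss⁺ ; grid = grid⁺ }
      where
      s : ℕ
      s = proj₁ (sparse-cut U? L)
      W? : Decidable (Chopped L s)
      W? v = U? v ×-dec ¬? (cut? L s v)
      M : Layering (Chopped L s)
      M = layering W?
      open Pieces (pieces k W? M (U⊆U₀ ∘ proj₁))
      loss⁺ : Δ * # (λ v → ¬? (U′? v)) ≤ Δ * # (λ v → ¬? (U? v)) + suc k * n G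
      loss⁺ = begin
        Δ * # (λ v → ¬? (U′? v))                                 ≤⟨ loss ⟩
        Δ * # (λ v → ¬? (W? v)) + k * n G                        ≤⟨ +-monoˡ-≤ (k * n G) (*-monoʳ-≤ Δ
          (#-∪ (λ v → ¬? (W? v)) (λ v → ¬? (U? v)) (λ v → U? v ×-dec cut? L s v) split)) ⟩
        Δ * (# (λ v → ¬? (U? v)) + # (λ v → U? v ×-dec cut? L s v)) + k * n G
          ≡⟨ cong (_+ k * n G) (*-distribˡ-+ Δ (# (λ v → ¬? (U? v))) _) ⟩
        Δ * # (λ v → ¬? (U? v)) + Δ * # (λ v → U? v ×-dec cut? L s v) + k * n G
          ≤⟨ +-monoˡ-≤ (k * n G) (+-monoʳ-≤ (Δ * # (λ v → ¬? (U? v))) (proj₂ (sparse-cut U? L))) ⟩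
        Δ * # (λ v → ¬? (U? v)) + n G + k * n G                  ≡⟨ +-assoc (Δ * # (λ v → ¬? (U? v))) (n G) (k * n G) ⟩
        Δ * # (λ v → ¬? (U? v)) + suc k * n G                    ∎
        where
        open ≤-Reasoning
        split : ∀ {v} → ¬ Chopped L s v → ¬ U v ⊎ (U v × Cut L s v)
        split {v} ¬W with U? v | cut? L s v
        ... | yes p | yes c = inj₂ (p , c)
        ... | yes p | no ¬c = contradiction (p , ¬c) ¬W
        ... | no ¬p | _     = inj₁ ¬p
      grid⁺ : ∀ {m} (u : Fin (suc (suc m)) → V) {ρ} → (∀ j → U′ (u j) × root L′ (u j) ≡ ρ) →
        ∀ {R} → Spread u R → suc k * (3 * Δ) + suc k * (3 * Δ) ≤ R → ∃ λ ρ′ → Grid u L ρ′ (suc k) (suc k * (3 * Δ))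
      grid⁺ u u∈ {R} sp R≥ with grid u u∈ sp (≤-trans (+-mono-≤ (m≤n+m _ (3 * Δ)) (m≤n+m _ (3 * Δ))) R≥)
      ... | ρ , g = step′ (band L s M ρ) g
        where
        step′ : (b : Band L M ρ) → Grid u M ρ k (k * (3 * Δ)) → ∃ λ ρ′ → Grid u L ρ′ (suc k) (suc k * (3 * Δ))
        step′ b g with Band.low b ≤? suc (Δ + Δ)
        ... | yes lo = contradiction
          (low-band u U? proj₁ U⊆U₀ L M ρ b g sp
            (≤-trans (≤-reflexive (cong (_+ (3 * Δ + k * (3 * Δ))) (+-comm (k * (3 * Δ)) (3 * Δ)))) R≥) lo {zero} {suc zero})
          λ ()
        -- Here `low` is at least `2Δ + 2`, and `e` is the excess.
        ... | no ¬lo = root L ρ , subst (Grid u L (root L ρ) (suc k)) (+-comm (k * (3 * Δ)) (3 * Δ))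
          (lift-grid u U? proj₁ U⊆U₀ L M ρ b g (Band.low b ∸ suc (suc (Δ + Δ)))
            (trans (≡.sym (m+[n∸m]≡n (≰⇒> ¬lo))) (rearrange Δ _)))
          where
          rearrange : ∀ Δ e → suc (suc (Δ + Δ)) + e ≡ suc (suc e) + Δ + Δ
          rearrange = solve-∀

    -- Merging column `h` with row `h` contracts a perfect matching of the bipartite minor. The
    -- resulting branch sets are pairwise adjacent, as column `h` touches every row, so they serve
    -- for any graph on these vertices.
    grid⇒minor : ∀ (H : Graph) (u : Fin (suc (suc (n H))) → V) {L : Layering U} {ρ d R} →
      Grid u L ρ (n H) d → Spread u R → d + d ≤ R → IsMinorOf H G
    grid⇒minor H u {d = d} g sp d≤R = (λ h → subset (B? h)) , nonempty , disjoint , connected , adjacent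
      where
      open Grid u g
      -- The first two columns are skipped: they are there to provide two distinct points even if
      -- `H` has fewer than two vertices.
      col : Fin (n H) → Fin (suc (suc (n H)))
      col h = suc (suc h)
      B : Fin (n H) → Pred V 0ℓ
      B h w = C (col h) w ⊎ T h w
      B? : ∀ h → Decidable (B h)
      B? h w = C? (col h) w ⊎-dec T? h w
      nonempty : ∀ h → Nonempty (subset (B? h))
      nonempty h = _ , ∈-subset⁺ (B? h) (inj₁ (tip∈ (col h)))
      disjointB : ∀ {h h′ v} → h ≢ h′ → B h v → B h′ v → ⊥
      -- A common vertex of two columns would join their starting points by a walk of length at most
      -- `d + d`.
      disjointB neq (inj₁ c) (inj₁ c′) = sp (neq ∘ Fin.suc-injective ∘ Fin.suc-injective)
        (near-mono id d≤R (near-trans (C-near c) (near-sym (C-near c′))))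
      disjointB neq (inj₁ c) (inj₂ t′) = CT c t′
      disjointB neq (inj₂ t) (inj₁ c′) = CT c′ t
      disjointB neq (inj₂ t) (inj₂ t′) = TT neq t t′
      disjoint : ∀ h h′ → h ≢ h′ → Disjoint (subset (B? h)) (subset (B? h′))
      disjoint h h′ neq v p q = disjointB neq (∈-subset⁻ (B? h) p) (∈-subset⁻ (B? h′) q)
      to-center : ∀ h {v} → B h v → Walk (B h) v (u (col h))
      to-center h (inj₁ c) = walk-mono inj₁ (C-conn (col h) c)
      to-center h (inj₂ t) with C~T (col h) h | T-conn h
      ... | x , y , cx , ty , e | z , conn = walk-trans (walk-mono inj₂ (walk-trans (conn t) (walk-sym (conn ty))))
        (move (inj₂ ty) (~-sym e) (walk-mono inj₁ (C-conn (col h) cx)))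
      toWalkIn : ∀ h {v w} → Walk (B h) v w → WalkIn G (subset (B? h)) v w
      toWalkIn h (halt p)     = here (∈-subset⁺ (B? h) p)
      toWalkIn h (move p e q) = step (∈-subset⁺ (B? h) p) e (toWalkIn h q)
      connected : ∀ h → ConnectedIn G (subset (B? h))
      connected h v w p q = toWalkIn h
        (walk-trans (to-center h (∈-subset⁻ (B? h) p)) (walk-sym (to-center h (∈-subset⁻ (B? h) q))))
      adjacent : ∀ h h′ → adj H h h′ ≡ true → ∃ λ v → ∃ λ w → v Subset.∈ subset (B? h) ×
        w Subset.∈ subset (B? h′) × adj G v w ≡ true
      adjacent h h′ _ with C~T (col h) h′
      ... | x , y , c , t , e = x , y , ∈-subset⁺ (B? h) (inj₁ c) , ∈-subset⁺ (B? h′) (inj₂ t) , e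

  -- Balls among low-degree vertices, and greedy packing.

  module Balls where
    open Counting

    length-filter-tabulate : ∀ {A : Set} {P : Pred A 0ℓ} (P? : Decidable P) {k} (f : Fin k → A) →
      length (filter P? (tabulate f)) ≡ # (P? ∘ f)
    length-filter-tabulate P? {zero}  f = refl
    length-filter-tabulate P? {suc k} f with P? (f zero)
    ... | yes _ = cong suc (length-filter-tabulate P? (f ∘ suc))
    ... | no _  = length-filter-tabulate P? (f ∘ suc)

    length-concatMap : ∀ {A B : Set} (f : A → List B) {c} → (∀ x → length (f x) ≤ c) →
      ∀ xs → length (concatMap f xs) ≤ length xs * c
    length-concatMap f small []       = z≤n
    length-concatMap f small (x ∷ xs) = ≤-trans (≤-reflexive (length-++ (f x)))
      (+-mono-≤ (small x) (length-concatMap f small xs))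

    ballSize : ℕ → ℕ → ℕ
    ballSize D zero    = 1
    ballSize D (suc r) = suc (D * ballSize D r)

    module _ (G : Graph) (D : ℕ) where
      open Walks G

      degree : V → ℕ
      degree v = # (v ~?_)

      LowDegree : Pred V 0ℓ
      LowDegree v = degree v ≤ D

      -- Empty at vertices of large degree, so that `D` bounds the length everywhere; walks inside
      -- `LowDegree` never leave from such a vertex.
      neighbours : V → List V
      neighbours v with degree v ≤? D
      ... | yes _ = filter (v ~?_) (allFin (n G))
      ... | no _  = []

      length-neighbours : ∀ v → length (neighbours v) ≤ D
      length-neighbours v with degree v ≤? D
      ... | yes d≤D = ≤-trans (≤-reflexive (length-filter-tabulate (v ~?_) id)) d≤D
      ... | no _    = z≤n

      ∈-neighbours : ∀ {v w} → LowDegree v → v ~ w → w ∈ neighbours v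
      ∈-neighbours {v} {w} d≤D e with degree v ≤? D
      ... | yes _ = ∈-filter⁺ (v ~?_) (∈-allFin w) e
      ... | no ≰D = contradiction d≤D ≰D

      ball : ℕ → V → List V
      ball zero    v = v ∷ []
      ball (suc r) v = v ∷ concatMap (ball r) (neighbours v)

      length-ball : ∀ r v → length (ball r v) ≤ ballSize D r
      length-ball zero    v = ≤-refl
      length-ball (suc r) v = s≤s (≤-trans (length-concatMap (ball r) (length-ball r) (neighbours v))
        (*-monoˡ-≤ (ballSize D r) (length-neighbours v)))

      near⇒∈ball : ∀ {r v w} → Near LowDegree r v w → w ∈ ball r v
      near⇒∈ball {zero}  stay = here refl
      near⇒∈ball {suc r} stay = here refl
      near⇒∈ball (move {r} p q e N) = there (∈-concatMap⁺ (ball r) (lose (∈-neighbours p e) (near⇒∈ball N)))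

      open import Data.List.Membership.DecPropositional (Fin._≟_ {n G}) using (_∈?_)

      -- Greedy choice: a vertex of `K` outside the balls around the points chosen so far is a
      -- further point; if there is none, these balls cover `K`.
      packing : ∀ {K : Pred V 0ℓ} (K? : Decidable K) (R m : ℕ) →
        (∃ λ (u : Fin m → V) → (∀ j → K (u j)) × (∀ {i j} → i ≢ j → ¬ Near LowDegree R (u i) (u j)))
        ⊎ # K? ≤ m * ballSize D R
      packing K? R zero = inj₁ ((λ ()) , (λ ()) , λ { {()} })
      packing {K} K? R (suc m) with packing K? R m
      ... | inj₂ small = inj₂ (≤-trans small (m≤n+m _ (ballSize D R)))
      ... | inj₁ (u , u∈ , sp) with Fin.any? (λ w → K? w ×-dec ¬? (w ∈? concatMap (ball R) (tabulate u)))
      ... | yes (w , Kw , w∉) = inj₁ (u′ , u′∈ , sp′)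
        where
        u′ : Fin (suc m) → V
        u′ zero    = w
        u′ (suc j) = u j
        u′∈ : ∀ j → K (u′ j)
        u′∈ zero    = Kw
        u′∈ (suc j) = u∈ j
        away : ∀ j → ¬ Near LowDegree R (u j) w
        away j N = w∉ (∈-concatMap⁺ (ball R) (lose (∈-tabulate⁺ j) (near⇒∈ball N)))
        sp′ : ∀ {i j} → i ≢ j → ¬ Near LowDegree R (u′ i) (u′ j)
        sp′ {zero}  {zero}  neq _ = neq refl
        sp′ {zero}  {suc j} neq N = away j (near-sym N)
        sp′ {suc i} {zero}  neq N = away i N
        sp′ {suc i} {suc j} neq N = sp (neq ∘ cong suc) N
      ... | no covered = inj₂ (≤-trans (#≤length K? (concatMap (ball R) (tabulate u)) cover)
        (≤-trans (length-concatMap (ball R) (length-ball R) (tabulate u))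
          (≤-trans (≤-reflexive (cong (_* ballSize D R) (length-tabulate u))) (m≤n+m _ (ballSize D R)))))
        where
        cover : ∀ {w} → K w → w ∈ concatMap (ball R) (tabulate u)
        cover {w} Kw with w ∈? concatMap (ball R) (tabulate u)
        ... | yes w∈ = w∈
        ... | no w∉  = contradiction (w , Kw , w∉) covered

  -- Edge counting and the closure under many neighbours.

  module Islands where
    open Counting
    open Subsets
    open Balls

    count≡sumFin : ∀ {k} (f : Fin k → Bool) → count f ≡ sumFin (λ i → if f i then 1 else 0)
    count≡sumFin {zero}  f = refl
    count≡sumFin {suc k} f = cong ((if f zero then 1 else 0) +_) (count≡sumFin (f ∘ suc))

    count-≤ : ∀ {k} (f : Fin k → Bool) {P : Pred (Fin k) 0ℓ} (P? : Decidable P) →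
      (∀ i → f i ≡ true → P i) → count f ≤ # P?
    count-≤ f P? h = ≤-trans (≤-reflexive (count≡sumFin f)) (sumFin-mono λ i → bound (f i) (P? i) (h i))
      where
      bound : ∀ {A : Set} b (a : Dec A) → (b ≡ true → A) → (if b then 1 else 0) ≤ 𝟙 a
      bound false a h = z≤n
      bound true  a h = 𝟙-yes a (h refl)

    does-≟-true : ∀ b → does (b Bool.≟ true) ≡ b
    does-≟-true false = refl
    does-≟-true true  = refl

    module _ (G : Graph) where
      open Walks G

      handshake : sumFin (λ v → # (v ~?_)) ≤ ∣E∣ G + ∣E∣ G
      handshake = begin
        sumFin (λ i → sumFin (λ j → 𝟙 (i ~? j)))
          ≤⟨ sumFin-mono (λ i → #-∪ (i ~?_) (up? i) (λ j → up? j i) (λ e → orient e)) ⟩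
        sumFin (λ i → # (up? i) + # (λ j → up? j i))
          ≡⟨ sumFin-+ (λ i → # (up? i)) (λ i → # (λ j → up? j i)) ⟩
        sumFin (λ i → # (up? i)) + sumFin (λ i → # (λ j → up? j i))
          ≡⟨ cong (sumFin (λ i → # (up? i)) +_) (sumFin-swap (λ i j → 𝟙 (up? j i))) ⟩
        sumFin (λ i → # (up? i)) + sumFin (λ i → # (up? i))
          ≡⟨ cong₂ _+_ edges edges ⟨
        ∣E∣ G + ∣E∣ G                                                       ∎
        where
        open ≤-Reasoning
        up? : (i j : V) → Dec (i ~ j × toℕ i < toℕ j)
        up? i j = (i ~? j) ×-dec (toℕ i <? toℕ j)
        orient : ∀ {i j} → i ~ j → (i ~ j × toℕ i < toℕ j) ⊎ (j ~ i × toℕ j < toℕ i)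
        orient {i} {j} e with <-cmp (toℕ i) (toℕ j)
        ... | tri< lt _ _ = inj₁ (e , lt)
        ... | tri≈ _ eq _ with refl ← Fin.toℕ-injective eq = contradiction e ~-irrefl
        ... | tri> _ _ gt = inj₂ (~-sym e , gt)
        edges : ∣E∣ G ≡ sumFin (λ i → # (up? i))
        edges = sumFin-cong λ i → trans (count≡sumFin (λ j → adj G i j ∧ (toℕ i <ᵇ toℕ j)))
          (sumFin-cong λ j → cong (λ b → if b ∧ (toℕ i <ᵇ toℕ j) then 1 else 0) (≡.sym (does-≟-true (adj G i j))))

      -- Twice the number of edges inside Q.
      inner : {Q : Pred V 0ℓ} → Decidable Q → ℕ
      inner Q? = sumFin (λ v → # (λ w → Q? v ×-dec Q? w ×-dec (v ~? w)))

      inner-≤ : {Q : Pred V 0ℓ} (Q? : Decidable Q) → inner Q? ≤ ∣E∣ G + ∣E∣ G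
      inner-≤ Q? = ≤-trans
        (sumFin-mono λ v → #-mono (λ w → Q? v ×-dec Q? w ×-dec (v ~? w)) (v ~?_) (λ (_ , _ , e) → e)) handshake

      -- For every neighbour `w` of `x` in `Q`, both ordered pairs `(x , w)` and `(w , x)` are new,
      -- and they are distinct, because `x` lies outside `Q`.
      inner-insert : {Q : Pred V 0ℓ} (Q? : Decidable Q) → ∀ {x} → ¬ Q x →
        inner Q? + (# (λ w → Q? w ×-dec (x ~? w)) + # (λ w → Q? w ×-dec (x ~? w)))
        ≤ inner (λ v → Q? v ⊎-dec (v Fin.≟ x))
      inner-insert {Q} Q? {x} ¬Qx = begin
        inner Q? + (d + d)                                     ≤⟨ +-monoʳ-≤ (inner Q?) (+-mono-≤ row column) ⟩
        inner Q? + (sumFin (λ v → # (R? v)) + sumFin (λ v → # (λ w → R? w v)))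
          ≡⟨ cong (inner Q? +_) (sumFin-+ (λ v → # (R? v)) (λ v → # (λ w → R? w v))) ⟨
        inner Q? + sumFin (λ v → # (R? v) + # (λ w → R? w v))  ≡⟨ sumFin-+ (λ v → # (I? v)) (λ v → # (R? v) + # (λ w → R? w v)) ⟨
        sumFin (λ v → # (I? v) + (# (R? v) + # (λ w → R? w v)))
          ≤⟨ sumFin-mono (λ v → ≤-trans (+-monoʳ-≤ (# (I? v)) (#-disjoint (R? v) (λ w → R? w v) (λ w → R? v w ⊎-dec R? w v)
               inj₁ inj₂ (λ { (refl , _ , _) (refl , q , _) → ¬Qx q })))
             (#-disjoint (I? v) (λ w → R? v w ⊎-dec R? w v) (λ w → Q⁺? v ×-dec Q⁺? w ×-dec (v ~? w))
               (λ (p , q , e) → inj₁ p , inj₁ q , e)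
               (λ { (inj₁ (eq , q , e)) → inj₂ eq , inj₁ q , subst (_~ _) (≡.sym eq) e
                  ; (inj₂ (eq , q , e)) → inj₁ q , inj₂ eq , subst (_ ~_) (≡.sym eq) (~-sym e) })
               (λ { (p , _ , _) (inj₁ (refl , _ , _)) → ¬Qx p ; (_ , q , _) (inj₂ (refl , _ , _)) → ¬Qx q }))) ⟩
        inner Q⁺?                                              ∎
        where
        open ≤-Reasoning
        d : ℕ
        d = # (λ w → Q? w ×-dec (x ~? w))
        Q⁺? : Decidable (λ v → Q v ⊎ v ≡ x)
        Q⁺? v = Q? v ⊎-dec (v Fin.≟ x)
        I? : (v w : V) → Dec (Q v × Q w × v ~ w)
        I? v w = Q? v ×-dec Q? w ×-dec (v ~? w)
        R? : (v w : V) → Dec (v ≡ x × Q w × x ~ w)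
        R? v w = (v Fin.≟ x) ×-dec Q? w ×-dec (x ~? w)
        row : d ≤ sumFin (λ v → # (R? v))
        row = ≤-trans (#-mono (λ w → Q? w ×-dec (x ~? w)) (R? x) (λ (q , e) → refl , q , e)) (term≤sumFin (λ v → # (R? v)) x)
        column : d ≤ sumFin (λ v → # (λ w → R? w v))
        column = ≤-trans row (≤-reflexive (sumFin-swap (λ v w → 𝟙 (R? v w))))

      module _ (t : ℕ) {X : Pred V 0ℓ} (X? : Decidable X) where

        -- `inner` counts ordered pairs, whence `t + t`: each vertex added to `X` has brought at
        -- least `t` edges into `Q`.
        record Closed : Set₁ where
          field
            Q     : Pred V 0ℓ
            Q?    : Decidable Q
            X⊆Q   : ∀ {v} → X v → Q v
            stuck : ∀ {v} → ¬ Q v → # (λ w → Q? w ×-dec (v ~? w)) < t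
            bound : (t + t) * # Q? ≤ inner Q? + (t + t) * # X?

        close : Closed
        close = go _ X? id (m≤n+m _ (inner X?)) ≤-refl
          where
          go : ∀ k {Q : Pred V 0ℓ} (Q? : Decidable Q) → (∀ {v} → X v → Q v) →
            (t + t) * # Q? ≤ inner Q? + (t + t) * # X? → # (λ v → ¬? (Q? v)) < suc k → Closed
          go k {Q} Q? X⊆Q bound (s≤s fuel) with Fin.any? (λ v → ¬? (Q? v) ×-dec (t ≤? # (λ w → Q? w ×-dec (v ~? w))))
          ... | no none = record { Q = Q ; Q? = Q? ; X⊆Q = X⊆Q ; bound = bound
                                 ; stuck = λ ¬Qv → ≰⇒> (λ le → none (_ , ¬Qv , le)) }
          ... | yes (x , ¬Qx , le) with k
          ... | zero  = contradiction (≤-trans (#-nonempty (λ v → ¬? (Q? v)) ¬Qx) fuel) λ ()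
          ... | suc k = go k Q⁺? (inj₁ ∘ X⊆Q) bound⁺ (<-≤-trans
            (#-⊂ (λ v → ¬? (Q⁺? v)) (λ v → ¬? (Q? v)) (_∘ inj₁) ¬Qx (λ f → f (inj₂ refl))) fuel)
            where
            open ≤-Reasoning
            Q⁺? : Decidable (λ v → Q v ⊎ v ≡ x)
            Q⁺? v = Q? v ⊎-dec (v Fin.≟ x)
            rearrange : ∀ a b c → a + b + c ≡ a + c + b
            rearrange = solve-∀
            bound⁺ : (t + t) * # Q⁺? ≤ inner Q⁺? + (t + t) * # X?
            bound⁺ = begin
              (t + t) * # Q⁺?                            ≤⟨ *-monoʳ-≤ (t + t) (≤-trans (#-∪ Q⁺? Q? (Fin._≟ x) id)
                                                              (+-monoʳ-≤ (# Q?) (#≤1 (Fin._≟ x) (λ { refl refl → refl })))) ⟩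
              (t + t) * (# Q? + 1)
              ≡⟨ trans (*-distribˡ-+ (t + t) (# Q?) 1) (cong ((t + t) * # Q? +_) (*-identityʳ (t + t))) ⟩
              -- The neighbours of `x` in `Q` are counted twice, once for each order of the pair, so
              -- `le` enters twice.
              (t + t) * # Q? + (t + t)                   ≤⟨ +-mono-≤ bound (+-mono-≤ le le) ⟩
              inner Q? + (t + t) * # X? + (# (λ w → Q? w ×-dec (x ~? w)) + # (λ w → Q? w ×-dec (x ~? w)))
                                                         ≡⟨ rearrange (inner Q?) ((t + t) * # X?) _ ⟩
              inner Q? + (# (λ w → Q? w ×-dec (x ~? w)) + # (λ w → Q? w ×-dec (x ~? w))) + (t + t) * # X?
                                                         ≤⟨ +-monoˡ-≤ ((t + t) * # X?) (inner-insert Q? ¬Qx) ⟩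
              inner Q⁺? + (t + t) * # X?                 ∎

  -- The islands, the constants and the final count.

  module Assembly where
    open Counting
    open Subsets
    open Balls
    open Islands

    markov : ∀ {k} (f : Fin k → ℕ) c → suc c * # (λ i → ¬? (f i ≤? c)) ≤ sumFin f
    markov {zero}  f c = ≤-reflexive (*-zeroʳ c)
    markov {suc k} f c = ≤-trans
      (≤-reflexive (*-distribˡ-+ (suc c) (𝟙 (¬? (f zero ≤? c))) (# (λ i → ¬? (f (suc i) ≤? c)))))
      (+-mono-≤ (first (f zero ≤? c)) (markov (f ∘ suc) c))
      where
      first : ∀ {x} (d : Dec (x ≤ c)) → suc c * 𝟙 (¬? d) ≤ x
      first (yes _) = ≤-trans (≤-reflexive (*-zeroʳ c)) z≤n
      first (no ≰c) = ≤-trans (≤-reflexive (*-identityʳ (suc c))) (≰⇒> ≰c)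

    -- The islands are the traces of the pieces on the complement of the closed set Q.
    module _ (G : Graph) (t : ℕ) {U : Pred (Fin (n G)) 0ℓ} (U? : Decidable U) (L : Walks.Layering G U) (C : ℕ) where
      open Walks G
      open Layering L

      island-list : (∀ ρ → # (λ v → U? v ×-dec (root v Fin.≟ ρ)) ≤ C) →
        {Q : Pred V 0ℓ} (Q? : Decidable Q) → (∀ {v} → ¬ U v → Q v) →
        (∀ {v} → ¬ Q v → # (λ w → Q? w ×-dec (v ~? w)) < t) →
        ∃ λ (Is : List (Subset (n G))) → AllPairs Disjoint Is × All (IsIsland G t) Is × # (λ v → ¬? (Q? v)) ≤ length Is * C
      island-list small {Q} Q? ¬U⊆Q stuck = map I roots , pairwise , islands , large
        where
        I? : ∀ ρ → Decidable (λ v → ¬ Q v × root v ≡ ρ)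
        I? ρ v = ¬? (Q? v) ×-dec (root v Fin.≟ ρ)
        I : V → Subset (n G)
        I ρ = subset (I? ρ)
        occupied? : Decidable (λ ρ → ∃ λ v → ¬ Q v × root v ≡ ρ)
        occupied? ρ = Fin.any? (I? ρ)
        roots : List V
        roots = filter occupied? (allFin (n G))
        U-out : ∀ {v} → ¬ Q v → U v
        U-out {v} ¬Qv with U? v
        ... | yes Uv = Uv
        ... | no ¬Uv = contradiction (¬U⊆Q ¬Uv) ¬Qv
        pairwise : AllPairs Disjoint (map I roots)
        pairwise = AllPairs.map⁺ (AllPairs.map
          (λ {ρ} {ρ′} neq v p q → neq (trans (≡.sym (proj₂ (∈-subset⁻ (I? ρ) p))) (proj₂ (∈-subset⁻ (I? ρ′) q))))
          (filter⁺ occupied? (allFin⁺ (n G))))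
        islands : All (IsIsland G t) (map I roots)
        islands = All.map⁺ (All.map island (All.all-filter occupied? (allFin (n G))))
          where
          island : ∀ {ρ} → (∃ λ v → ¬ Q v × root v ≡ ρ) → IsIsland G t (I ρ)
          island {ρ} (v , v∈) = (v , ∈-subset⁺ (I? ρ) v∈) , λ w w∈ → let ¬Qw , eq = ∈-subset⁻ (I? ρ) w∈ in
            ≤-<-trans (count-≤ (λ x → adj G w x ∧ not (Vec.lookup (I ρ) x)) (λ x → Q? x ×-dec (w ~? x))
              (outside w ¬Qw eq)) (stuck ¬Qw)
            where
            outside : ∀ w → ¬ Q w → root w ≡ ρ → ∀ x → adj G w x ∧ not (Vec.lookup (I ρ) x) ≡ true → Q x × w ~ x
            outside w ¬Qw eq x b with adj G w x in e | Vec.lookup (I ρ) x in l | Q? x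
            ... | true | false | yes Qx = Qx , refl
            -- A neighbour outside `Q` lies in `U` and hence has the same root as `w`, which puts it
            -- into the island itself.
            ... | true | false | no ¬Qx with () ← trans (≡.sym l) ([]=⇒lookup (∈-subset⁺ (I? ρ)
              (¬Qx , trans (≡.sym (root-~ (U-out ¬Qw) (U-out ¬Qx) e)) eq)))
        large : # (λ v → ¬? (Q? v)) ≤ length (map I roots) * C
        large = subst (λ l → # (λ v → ¬? (Q? v)) ≤ l * C) (≡.sym (length-map I roots))
          (#-fibres (λ v → ¬? (Q? v)) root C roots
            (λ {v} ¬Qv → ∈-filter⁺ occupied? (∈-allFin (root v)) (v , ¬Qv , refl))
            (λ ρ → ≤-trans (#-mono (I? ρ) (λ v → U? v ×-dec (root v Fin.≟ ρ)) (λ (¬Qv , eq) → U-out ¬Qv , eq)) (small ρ)))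

    module _ (q t : ℕ) .{{_ : ℕ.NonZero q}} .{{_ : ℕ.NonZero t}} where

      -- Degrees add up to at most `2tN`, so at most `N / a` vertices exceed the threshold
      -- `(t + t) * a`. With Δ equal to `1 + a * h`, the `h` cuts cost at most `hN / Δ`, again no
      -- more than `N / a`. As `a` is `2b`, the total is at most `N / b`.
      few-deleted : ∀ {N E x x₀} h → let b = q * (t + t) ; a = b + b in
        q * E + N ≤ q * (t * N) → suc ((t + t) * a) * x₀ ≤ E + E → suc (a * h) * x ≤ suc (a * h) * x₀ + h * N → b * x ≤ N
      few-deleted {N} {E} {x} {x₀} h sparse high loss = *-cancelˡ-≤ 2 (≤-trans (≤-reflexive (double b x))
        (≤-trans ax≤ (≤-reflexive (cong (N +_) (≡.sym (+-identityʳ N))))))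
        where
        open ≤-Reasoning
        b a Δ : ℕ
        b = q * (t + t)
        a = b + b
        Δ = suc (a * h)
        double : ∀ b x → 2 * (b * x) ≡ (b + b) * x
        double = solve-∀
        E≤ : E ≤ t * N
        E≤ = *-cancelˡ-≤ q (≤-trans (m≤m+n (q * E) N) sparse)
        instance
          t+t≢0 : ℕ.NonZero (t + t)
          t+t≢0 = ℕ.>-nonZero (≤-trans (ℕ.>-nonZero⁻¹ t) (m≤m+n t t))
        ax₀≤ : a * x₀ ≤ N
        ax₀≤ = *-cancelˡ-≤ (t + t) (begin
          (t + t) * (a * x₀)      ≡⟨ *-assoc (t + t) a x₀ ⟨
          (t + t) * a * x₀        ≤⟨ m≤n+m _ x₀ ⟩
          suc ((t + t) * a) * x₀  ≤⟨ high ⟩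
          E + E                   ≤⟨ +-mono-≤ E≤ E≤ ⟩
          t * N + t * N           ≡⟨ *-distribʳ-+ N t t ⟨
          (t + t) * N             ∎)
        ax≤ : a * x ≤ N + N
        ax≤ = *-cancelˡ-≤ Δ (begin
          Δ * (a * x)                 ≡⟨ swap Δ a x ⟩
          a * (Δ * x)                 ≤⟨ *-monoʳ-≤ a loss ⟩
          a * (Δ * x₀ + h * N)        ≡⟨ expand a Δ x₀ h N ⟩
          Δ * (a * x₀) + a * h * N    ≤⟨ +-mono-≤ (*-monoʳ-≤ Δ ax₀≤) (m≤n+m _ N) ⟩
          Δ * N + Δ * N               ≡⟨ *-distribˡ-+ Δ N N ⟨
          Δ * (N + N)                 ∎)
          where
          swap : ∀ d a x → d * (a * x) ≡ a * (d * x)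
          swap = solve-∀
          expand : ∀ a d y h N → a * (d * y + h * N) ≡ d * (a * y) + a * h * N
          expand = solve-∀

      -- The edge bound, doubled, reads `2qE + 2N ≤ bN`; the closure gives
      -- `bQ ≤ 2qE + bx ≤ 2qE + N`. With `N ≤ Q + S` the difference is `N ≤ bS`.
      many-left : ∀ {N E x Q S i} → let b = q * (t + t) in
        q * E + N ≤ q * (t * N) → b * x ≤ N → (t + t) * Q ≤ i + (t + t) * x → i ≤ E + E → N ≤ Q + S → N ≤ b * S
      many-left {N} {E} {x} {Q} {S} {i} sparse few closed inner≤ total = +-cancelˡ-≤ (q * E + q * E + N) N (b * S) (begin
        q * E + q * E + N + N            ≡⟨ regroup (q * E) N ⟩
        (q * E + N) + (q * E + N)        ≤⟨ +-mono-≤ sparse sparse ⟩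
        q * (t * N) + q * (t * N)        ≡⟨ factor q t N ⟩
        b * N                            ≤⟨ *-monoʳ-≤ b total ⟩
        b * (Q + S)                      ≡⟨ split q t Q S ⟩
        q * ((t + t) * Q) + b * S        ≤⟨ +-monoˡ-≤ (b * S) (*-monoʳ-≤ q (≤-trans closed (+-monoˡ-≤ _ inner≤))) ⟩
        q * ((E + E) + (t + t) * x) + b * S  ≡⟨ spread q t E x (b * S) ⟩
        q * E + q * E + b * x + b * S    ≤⟨ +-monoˡ-≤ (b * S) (+-monoʳ-≤ (q * E + q * E) few) ⟩
        q * E + q * E + N + b * S        ∎)
        where
        open ≤-Reasoning
        b : ℕ
        b = q * (t + t)
        regroup : ∀ e N → e + e + N + N ≡ (e + N) + (e + N)
        regroup = solve-∀
        factor : ∀ q t N → q * (t * N) + q * (t * N) ≡ q * (t + t) * N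
        factor = solve-∀
        split : ∀ q t Q S → q * (t + t) * (Q + S) ≡ q * ((t + t) * Q) + q * (t + t) * S
        split = solve-∀
        spread : ∀ q t E x y → q * ((E + E) + (t + t) * x) + y ≡ q * E + q * E + q * (t + t) * x + y
        spread = solve-∀

      disjoint-islands : (H : Graph) → ∃ λ K → (G : Graph) → MinorFree H G → q * ∣E∣ G + n G ≤ q * (t * n G) →
        ∃ λ (Is : List (Subset (n G))) → AllPairs Disjoint Is × All (IsIsland G t) Is × n G ≤ K * length Is
      disjoint-islands H = b * C , main
        where
        b a h Δ D R C : ℕ
        b = q * (t + t)
        a = b + b
        h = n H
        Δ = suc (a * h)
        D = (t + t) * a
        -- Twice the reach of a column after `h` lifts, as two columns meet halfway.
        R = h * (3 * Δ) + h * (3 * Δ)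
        -- In an `H`-minor-free graph no piece has `h + 2` points pairwise further apart than `R`,
        -- so the packing bound applies to every piece.
        C = suc (suc h) * ballSize D R
        main : (G : Graph) → MinorFree H G → q * ∣E∣ G + n G ≤ q * (t * n G) →
          ∃ λ (Is : List (Subset (n G))) → AllPairs Disjoint Is × All (IsIsland G t) Is × n G ≤ b * C * length Is
        main G free sparse = Is , proj₁ (proj₂ found) , proj₁ (proj₂ (proj₂ found)) , (begin
          n G                ≤⟨ many-left sparse few (Closed.bound Q) (inner-≤ G Q?) total ⟩
          b * # (λ v → ¬? (Q? v))   ≤⟨ *-monoʳ-≤ b (proj₂ (proj₂ (proj₂ found))) ⟩
          b * (length Is * C)  ≡⟨ rearrange b (length Is) C ⟩
          b * C * length Is  ∎)
          where
          open ≤-Reasoning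
          open Walks G
          rearrange : ∀ b l C → b * (l * C) ≡ b * C * l
          rearrange = solve-∀
          U₀? : Decidable (LowDegree G D)
          U₀? v = degree G D v ≤? D
          open Fragments G (LowDegree G D) Δ
          open Pieces (pieces h U₀? (layering U₀?) id)
          small : ∀ ρ → # (λ v → U′? v ×-dec (Layering.root L′ v Fin.≟ ρ)) ≤ C
          small ρ with packing G D (λ v → U′? v ×-dec (Layering.root L′ v Fin.≟ ρ)) R (suc (suc h))
          ... | inj₂ le = le
          ... | inj₁ (u , u∈ , sp) = contradiction
            (grid⇒minor H u (proj₂ (grid u u∈ sp ≤-refl)) sp ≤-refl) free
          few : b * # (λ v → ¬? (U′? v)) ≤ n G
          few = few-deleted h sparse (≤-trans (markov (degree G D) D) (handshake G)) loss
          Q : Closed G t (λ v → ¬? (U′? v))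
          Q = close G t (λ v → ¬? (U′? v))
          open Closed Q using (Q?; X⊆Q; stuck)
          total : n G ≤ # Q? + # (λ v → ¬? (Q? v))
          total = ≤-trans (≤-reflexive (≡.sym (#-total {n G} (λ v → Q? v ⊎-dec ¬? (Q? v)) excluded)))
            (#-∪ (λ v → Q? v ⊎-dec ¬? (Q? v)) Q? (λ v → ¬? (Q? v)) id)
            where
            excluded : ∀ v → Closed.Q Q v ⊎ ¬ Closed.Q Q v
            excluded v with Q? v
            ... | yes p = inj₁ p
            ... | no ¬p = inj₂ ¬p
          found = island-list G t U′? L′ C small Q? X⊆Q stuck
          Is = proj₁ found

open import Data.Nat using (ℕ; _>_)
open import Data.Product using (Σ; ∃; _×_; _,_)
open import Data.List using (List; length)
open import Data.List.Relation.Unary.All using (All)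
open import Data.List.Relation.Unary.AllPairs using (AllPairs)
open import Data.Fin.Subset using (Subset)
open import Data.Integer using (+_)
open import Data.Rational using (ℚ; 0ℚ; _<_; _≤_; _*_; _-_; _/_)

-- From rational to natural inequalities and back.

module Rationals where
  open import Data.Nat using (suc; s≤s; z≤n)
  import Data.Nat as ℕ
  import Data.Nat.Properties as ℕ
  open import Data.Integer using (ℤ)
  import Data.Integer as ℤ
  import Data.Integer.Properties as ℤ
  open import Data.Integer.Tactic.RingSolver using (solve-∀)
  open import Data.Nat.Tactic.RingSolver using () renaming (solve-∀ to ℕ-solve-∀)
  open import Data.Rational using (mkℚ; toℚᵘ; fromℚᵘ; *<*; -_; _+_)
  open import Data.Rational.Properties
  import Data.Rational.Unnormalised as ℚᵘ
  open ℚᵘ using (mkℚᵘ)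
  import Data.Rational.Unnormalised.Properties as ℚᵘ
  open import Relation.Binary.PropositionalEquality using (_≡_; cong; cong₂; subst₂; trans) renaming (sym to ≡-sym)

  toℚᵘ-ℕ : ∀ m → toℚᵘ (+ m / 1) ℚᵘ.≃ mkℚᵘ (+ m) 0
  toℚᵘ-ℕ m = toℚᵘ-fromℚᵘ (mkℚᵘ (+ m) 0)

  -- A positive fraction with denominator `q + 1` is at least `1 / (q + 1)`; multiplying by `q + 1`
  -- turns this into the term `N`.
  clear-denominators : ∀ α → 0ℚ < α → ∃ λ q → ∀ E t N →
    (+ E / 1) ≤ ((+ t / 1) - α) * (+ N / 1) → suc q ℕ.* E ℕ.+ N ℕ.≤ suc q ℕ.* (t ℕ.* N)
  clear-denominators (mkℚ (+ 0)        q c) (*<* (ℤ.+<+ ()))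
  clear-denominators α@(mkℚ (+ (suc p)) q c) _ = q , main
    where
    main : ∀ E t N → (+ E / 1) ≤ ((+ t / 1) - α) * (+ N / 1) → suc q ℕ.* E ℕ.+ N ℕ.≤ suc q ℕ.* (t ℕ.* N)
    main E t N h = ℕ.≤-trans (ℕ.+-monoʳ-≤ (suc q ℕ.* E) (ℕ.m≤m+n N (p ℕ.* N)))
      -- Adding `(p + 1) * N` on both sides removes the subtraction, after which both sides are
      -- natural numbers.
      (ℤ.drop‿+≤+ (subst₂ ℤ._≤_ lhs rhs (ℤ.+-monoˡ-≤ (+ suc p ℤ.* + N) (ℚᵘ.drop-*≤* h′))))
      where
      h′ : mkℚᵘ (+ E) 0 ℚᵘ.≤ (mkℚᵘ (+ t) 0 ℚᵘ.- mkℚᵘ (+ suc p) q) ℚᵘ.* mkℚᵘ (+ N) 0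
      h′ = ℚᵘ.≤-respˡ-≃ (toℚᵘ-ℕ E) (ℚᵘ.≤-respʳ-≃
        (ℚᵘ.≃-trans (toℚᵘ-homo-* ((+ t / 1) - α) (+ N / 1)) (ℚᵘ.*-cong
          (ℚᵘ.≃-trans (toℚᵘ-homo-+ (+ t / 1) (- α)) (ℚᵘ.+-cong (toℚᵘ-ℕ t) (toℚᵘ-homo‿- α)))
          (toℚᵘ-ℕ N)))
        (toℚᵘ-mono-≤ h))
      lhs : + E ℤ.* + (suc (q ℕ.+ 0) ℕ.* 1) ℤ.+ + suc p ℤ.* + N ≡ + (suc q ℕ.* E ℕ.+ suc p ℕ.* N)
      lhs = cong₂ ℤ._+_ (trans (≡-sym (ℤ.pos-* E _)) (cong +_ (cross E q))) (≡-sym (ℤ.pos-* (suc p) N))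
        where
        cross : ∀ E q → E ℕ.* (suc (q ℕ.+ 0) ℕ.* 1) ≡ suc q ℕ.* E
        cross = ℕ-solve-∀
      rhs : (+ t ℤ.* + suc q ℤ.+ ℤ.- (+ suc p) ℤ.* + 1) ℤ.* + N ℤ.* + 1 ℤ.+ + suc p ℤ.* + N ≡ + (suc q ℕ.* (t ℕ.* N))
      rhs = trans (cancel (+ t) (+ suc q) (+ suc p) (+ N))
        (trans (cong (+ suc q ℤ.*_) (≡-sym (ℤ.pos-* t N))) (≡-sym (ℤ.pos-* (suc q) (t ℕ.* N))))
        where
        cancel : ∀ t q p N → (t ℤ.* q ℤ.+ ℤ.- p ℤ.* + 1) ℤ.* N ℤ.* + 1 ℤ.+ p ℤ.* N ≡ q ℤ.* (t ℤ.* N)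
        cancel = solve-∀
  clear-denominators (mkℚ (ℤ.-[1+ p ]) q c) (*<* ())

  -- `mkℚᵘ` stores the denominator minus one, so this is `1 / (K + 1)`, which is positive for every
  -- `K`.
  reciprocal : ℕ → ℚ
  reciprocal K = fromℚᵘ (mkℚᵘ (+ 1) K)

  0<reciprocal : ∀ K → 0ℚ < reciprocal K
  0<reciprocal K = toℚᵘ-cancel-< (ℚᵘ.<-respʳ-≃ (ℚᵘ.≃-sym (toℚᵘ-fromℚᵘ (mkℚᵘ (+ 1) K)))
    (ℚᵘ.*<* (ℤ.+<+ (s≤s z≤n))))

  reciprocal-≤ : ∀ K {N l} → N ℕ.≤ suc K ℕ.* l → reciprocal K * (+ N / 1) ≤ (+ l / 1)
  reciprocal-≤ K {N} {l} N≤ = toℚᵘ-cancel-≤ (ℚᵘ.≤-respˡ-≃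
    (ℚᵘ.≃-sym (ℚᵘ.≃-trans (toℚᵘ-homo-* (reciprocal K) (+ N / 1)) (ℚᵘ.*-cong (toℚᵘ-fromℚᵘ (mkℚᵘ (+ 1) K)) (toℚᵘ-ℕ N))))
    (ℚᵘ.≤-respʳ-≃ (ℚᵘ.≃-sym (toℚᵘ-ℕ l)) (ℚᵘ.*≤*
      (subst₂ ℤ._≤_ (numerator (+ N)) (trans (cong +_ (denominator K l)) (ℤ.pos-* l (suc K ℕ.* 1))) (ℤ.+≤+ N≤)))))
    where
    numerator : ∀ N → N ≡ + 1 ℤ.* N ℤ.* + 1
    numerator = solve-∀
    denominator : ∀ K l → suc K ℕ.* l ≡ l ℕ.* (suc K ℕ.* 1)
    denominator = ℕ-solve-∀

theorem18 : (H : Graph) (t : ℕ) → t > 0 → (α : ℚ) → 0ℚ < α →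
    ∃ λ (δ : ℚ) → 0ℚ < δ ×
    ((G : Graph) → MinorFree H G →
    (+ ∣E∣ G / 1) ≤ ((+ t / 1) - α) * (+ ∣V∣ G / 1) →
    ∃ λ (Is : List (Subset (∣V∣ G))) →
    AllPairs Disjoint Is × All (IsIsland G t) Is ×
    δ * (+ ∣V∣ G / 1) ≤ (+ length Is / 1))
theorem18 H t t>0 α 0<α =
  let q , clear = clear-denominators α 0<α
      K , islands = disjoint-islands (suc q) t {{_}} {{>-nonZero t>0}} H
  in reciprocal K , 0<reciprocal K , λ G free sparse →
    let Is , disjoint , all , large = islands G free (clear (∣E∣ G) t (∣V∣ G) sparse)
    in Is , disjoint , all , reciprocal-≤ K (≤-trans large (*-monoˡ-≤ (length Is) (n≤1+n K)))
  where
  open Rationals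
  open Combinatorics.Assembly
  open import Data.Nat using (suc; >-nonZero)
  open import Data.Nat.Properties using (≤-trans; *-monoˡ-≤; n≤1+n)
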